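{- Let $d \in \mathbb{N}$ and let $A \subset \mathbb{R}^d$ be a finite, spherical set whose circumradius satisfies $\mathrm{cr}(A) > \mathrm{diam}(A)/\sqrt{2}$. Then $A$ is not diameter-Ramsey.
   Context: $\mathbb{N}$ denotes the positive integers and $\|\cdot\|$ the Euclidean norm. The diameter of a set $P \subset \mathbb{R}^d$ is $\mathrm{diam}(P) := \sup\{\|x-y\| : x,y \in P\}$. A finite set $A \subset \mathbb{R}^d$ is called spherical if it lies on some sphere in $\mathbb{R}^d$, i.e. if there are $c \in \mathbb{R}^d$ and $\rho \ge 0$ with $\|x-c\| = \rho$ for all $x \in A$. The circumradius $\mathrm{cr}(A)$ of a spherical set $A \subset \mathbb{R}^d$ is the radius of the smallest sphere containing $A$, i.e. the smallest such $\rho$ (containing means that all points of $A$ lie on the sphere itself). Two sets, possibly in Euclidean spaces of different dimensions, are congruent if there is a distance-preserving bijection between them. A finite set $A \subset \mathbb{R}^d$ is called diameter-Ramsey if for every $r \in \mathbb{N}$ there exist $n \in \mathbb{N}$ and a finite set $B \subset \mathbb{R}^n$ with $\mathrm{diam}(B) = \mathrm{diam}(A)$ such that whenever the points of $B$ are coloured with $r$ colours, there is a monochromatic set $A' \subset B$ (all points of $A'$ have the same colour) which is congruent to $A$. -}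

module Defs where

open import Data.Fin.Base using (Fin)
open import Data.Integer.Base as ℤ using (+_)
import Data.Integer.Properties as ℤₚ
open import Data.Nat.Base as ℕ using (ℕ; zero; suc)
import Data.Nat.Coprimality as Coprime
import Data.Nat.Properties as ℕₚ
open import Data.Product using (Σ; ∃; ∃-syntax; _×_; _,_; proj₁; proj₂)
open import Data.Rational as ℚ using (ℚ; 0ℚ; 1ℚ; ½; ∣_∣)
import Data.Rational.Properties as ℚₚ
open import Data.Rational.Solver using (module +-*-Solver)
import Data.Rational.Unnormalised as ℚᵘ
import Data.Rational.Unnormalised.Properties as ℚᵘₚ
open import Data.Sum using (_⊎_; inj₁; inj₂)
open import Data.Vec.Functional using (Vector; foldr)
open import Function.Bundles using (_⤖_; module Bijection)
open import Level using (0ℓ)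
open import Relation.Binary.PropositionalEquality
  using (_≡_; refl; sym; trans; cong; cong₂; subst)
open import Relation.Nullary using (¬_; yes; no; contradiction)
open import Relation.Unary using (Pred)

-- Real numbers: Cauchy sequences of rationals, compared by the setoid
-- equality _≈_ below (difference tending to 0).

IsCauchy : (ℕ → ℚ) → Set
IsCauchy s = ∀ ε → 0ℚ ℚ.< ε →
  ∃[ N ] ∀ m n → N ℕ.≤ m → N ℕ.≤ n → ∣ s m ℚ.- s n ∣ ℚ.≤ ε

record ℝ : Set where
  constructor mkℝ
  field
    seq    : ℕ → ℚ
    cauchy : IsCauchy seq

open ℝ public

infix 4 _≈_ _≤_ _<_

_≈_ : ℝ → ℝ → Set
x ≈ y = ∀ ε → 0ℚ ℚ.< ε →
  ∃[ N ] ∀ n → N ℕ.≤ n → ∣ seq x n ℚ.- seq y n ∣ ℚ.≤ ε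

_≤_ : ℝ → ℝ → Set
x ≤ y = ∀ ε → 0ℚ ℚ.< ε →
  ∃[ N ] ∀ n → N ℕ.≤ n → seq x n ℚ.≤ seq y n ℚ.+ ε

_<_ : ℝ → ℝ → Set
x < y = ∃[ ε ] 0ℚ ℚ.< ε ×
  (∃[ N ] ∀ n → N ℕ.≤ n → seq x n ℚ.+ ε ℚ.≤ seq y n)

private
  <⇒≱ : ∀ {p q} → p ℚ.< q → ¬ (q ℚ.≤ p)
  <⇒≱ p<q q≤p = ℚₚ.<-irrefl refl (ℚₚ.<-≤-trans p<q q≤p)

  half-pos : ∀ {ε} → 0ℚ ℚ.< ε → 0ℚ ℚ.< ½ ℚ.* ε
  half-pos {ε} 0<ε =
    subst (ℚ._< ½ ℚ.* ε) (ℚₚ.*-zeroʳ ½) (ℚₚ.*-monoʳ-<-pos ½ 0<ε)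

  half+half : ∀ ε → ½ ℚ.* ε ℚ.+ ½ ℚ.* ε ≡ ε
  half+half = solve 1 (λ e → con ½ :* e :+ con ½ :* e := e) refl
    where open +-*-Solver

  pos*pos : ∀ {p q} → 0ℚ ℚ.< p → 0ℚ ℚ.< q → 0ℚ ℚ.< p ℚ.* q
  pos*pos {p} {q} 0<p 0<q = ℚₚ.positive⁻¹ (p ℚ.* q)
    {{ℚₚ.pos*pos⇒pos p {{ℚ.positive 0<p}} q {{ℚ.positive 0<q}}}}

  divide : ∀ E ε → 0ℚ ℚ.< E → 0ℚ ℚ.< ε → ∃[ δ ] 0ℚ ℚ.< δ × E ℚ.* δ ≡ ε
  divide E@record{} ε 0<E 0<ε =
    ℚ.1/ E ℚ.* ε ,
    pos*pos (ℚₚ.positive⁻¹ (ℚ.1/ E) {{ℚₚ.1/pos⇒pos E}}) 0<ε ,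
    trans (sym (ℚₚ.*-assoc E (ℚ.1/ E) ε))
      (trans (cong (ℚ._* ε) (ℚₚ.*-inverseʳ E)) (ℚₚ.*-identityˡ ε))
    where
    instance
      E-pos : ℚ.Positive E
      E-pos = ℚ.positive 0<E

      E-nonZero : ℚ.NonZero E
      E-nonZero = ℚₚ.pos⇒nonZero E

  *-mono-≤ : ∀ {p q r s} → 0ℚ ℚ.≤ r → 0ℚ ℚ.≤ q → p ℚ.≤ q → r ℚ.≤ s →
             p ℚ.* r ℚ.≤ q ℚ.* s
  *-mono-≤ {q = q} {r = r} 0≤r 0≤q p≤q r≤s = ℚₚ.≤-trans
    (ℚₚ.*-monoʳ-≤-nonNeg r {{ℚ.nonNegative 0≤r}} p≤q)
    (ℚₚ.*-monoˡ-≤-nonNeg q {{ℚ.nonNegative 0≤q}} r≤s)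

  ∣-∣-sym : ∀ p q → ∣ p ℚ.- q ∣ ≡ ∣ q ℚ.- p ∣
  ∣-∣-sym p q = trans (sym (ℚₚ.∣-p∣≡∣p∣ (p ℚ.- q)))
    (cong ∣_∣ (solve 2 (λ a b → :- (a :- b) := b :- a) refl p q))
    where open +-*-Solver

  p≤∣p∣ : ∀ p → p ℚ.≤ ∣ p ∣
  p≤∣p∣ p with ℚₚ.≤-total 0ℚ p
  ... | inj₁ 0≤p = ℚₚ.≤-reflexive (sym (ℚₚ.0≤p⇒∣p∣≡p 0≤p))
  ... | inj₂ p≤0 = ℚₚ.≤-trans p≤0 (ℚₚ.0≤∣p∣ p)

  ∣-∣≤⇒≤+ : ∀ {p q ε} → ∣ p ℚ.- q ∣ ℚ.≤ ε → p ℚ.≤ q ℚ.+ ε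
  ∣-∣≤⇒≤+ {p} {q} {ε} h = subst (ℚ._≤ q ℚ.+ ε)
    (solve 2 (λ a b → b :+ (a :- b) := a) refl p q)
    (ℚₚ.+-monoʳ-≤ q (ℚₚ.≤-trans (p≤∣p∣ (p ℚ.- q)) h))
    where open +-*-Solver

  ≤+⇒∣-∣≤ : ∀ {p q ε} → p ℚ.≤ q ℚ.+ ε → q ℚ.≤ p ℚ.+ ε → ∣ p ℚ.- q ∣ ℚ.≤ ε
  ≤+⇒∣-∣≤ {p} {q} {ε} h₁ h₂ with ℚₚ.∣p∣≡p∨∣p∣≡-p (p ℚ.- q)
  ... | inj₁ eq = subst (ℚ._≤ ε) (sym eq) (subst (p ℚ.- q ℚ.≤_)
    (solve 2 (λ b e → (b :+ e) :- b := e) refl q ε)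
    (ℚₚ.+-monoˡ-≤ (ℚ.- q) h₁))
    where open +-*-Solver
  ... | inj₂ eq = subst (ℚ._≤ ε) (sym eq) (subst (ℚ._≤ ε)
    (solve 2 (λ a b → b :- a := :- (a :- b)) refl p q)
    (subst (q ℚ.- p ℚ.≤_) (solve 2 (λ a e → (a :+ e) :- a := e) refl p ε)
      (ℚₚ.+-monoˡ-≤ (ℚ.- p) h₂)))
    where open +-*-Solver

fromℚ : ℚ → ℝ
fromℚ q = mkℝ (λ _ → q) λ ε 0<ε → 0 , λ _ _ _ _ →
  subst (ℚ._≤ ε) (sym (cong ∣_∣ (ℚₚ.+-inverseʳ q))) (ℚₚ.<⇒≤ 0<ε)

0ℝ : ℝ
0ℝ = fromℚ 0ℚ

private
  +-cauchy : ∀ s t → IsCauchy s → IsCauchy t → IsCauchy (λ n → s n ℚ.+ t n)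
  +-cauchy s t cs ct ε 0<ε =
    let (M , hM) = cs (½ ℚ.* ε) (half-pos 0<ε)
        (N , hN) = ct (½ ℚ.* ε) (half-pos 0<ε)
    in
    M ℕ.⊔ N , λ m n p q →
      let open ℚₚ.≤-Reasoning in begin
      ∣ (s m ℚ.+ t m) ℚ.- (s n ℚ.+ t n) ∣
        ≡⟨ cong ∣_∣ (rearrange (s m) (t m) (s n) (t n)) ⟩
      ∣ (s m ℚ.- s n) ℚ.+ (t m ℚ.- t n) ∣
        ≤⟨ ℚₚ.∣p+q∣≤∣p∣+∣q∣ (s m ℚ.- s n) (t m ℚ.- t n) ⟩
      ∣ s m ℚ.- s n ∣ ℚ.+ ∣ t m ℚ.- t n ∣
        ≤⟨ ℚₚ.+-mono-≤
             (hM m n (ℕₚ.m⊔n≤o⇒m≤o M N p) (ℕₚ.m⊔n≤o⇒m≤o M N q))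
             (hN m n (ℕₚ.m⊔n≤o⇒n≤o M N p) (ℕₚ.m⊔n≤o⇒n≤o M N q)) ⟩
      ½ ℚ.* ε ℚ.+ ½ ℚ.* ε
        ≡⟨ half+half ε ⟩
      ε ∎
    where
    open +-*-Solver
    rearrange : ∀ a b c d →
      (a ℚ.+ b) ℚ.- (c ℚ.+ d) ≡ (a ℚ.- c) ℚ.+ (b ℚ.- d)
    rearrange = solve 4
      (λ a b c d → (a :+ b) :- (c :+ d) := (a :- c) :+ (b :- d)) refl

  neg-cauchy : ∀ s → IsCauchy s → IsCauchy (λ n → ℚ.- s n)
  neg-cauchy s cs ε 0<ε =
    let (N , hN) = cs ε 0<ε in
    N , λ m n p q → subst (ℚ._≤ ε) (sym (flip (s m) (s n))) (hN m n p q)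
    where
    open +-*-Solver
    flip : ∀ a b → ∣ ℚ.- a ℚ.- (ℚ.- b) ∣ ≡ ∣ a ℚ.- b ∣
    flip a b = trans
      (cong ∣_∣ (solve 2 (λ a b → :- a :- (:- b) := b :- a) refl a b))
      (∣-∣-sym b a)

  bounded : ∀ s → IsCauchy s →
    ∃[ K ] 0ℚ ℚ.< K × (∃[ N ] ∀ n → N ℕ.≤ n → ∣ s n ∣ ℚ.≤ K)
  bounded s cs =
    let (N , hN) = cs 1ℚ (ℚₚ.positive⁻¹ 1ℚ) in
    ∣ s N ∣ ℚ.+ 1ℚ ,
    ℚₚ.+-mono-≤-< (ℚₚ.0≤∣p∣ (s N)) (ℚₚ.positive⁻¹ 1ℚ) ,
    N , λ n p →
      let open ℚₚ.≤-Reasoning in begin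
      ∣ s n ∣
        ≡⟨ cong ∣_∣ (solve 2 (λ a b → a := b :+ (a :- b)) refl (s n) (s N)) ⟩
      ∣ s N ℚ.+ (s n ℚ.- s N) ∣
        ≤⟨ ℚₚ.∣p+q∣≤∣p∣+∣q∣ (s N) (s n ℚ.- s N) ⟩
      ∣ s N ∣ ℚ.+ ∣ s n ℚ.- s N ∣
        ≤⟨ ℚₚ.+-monoʳ-≤ ∣ s N ∣ (hN n N p ℕₚ.≤-refl) ⟩
      ∣ s N ∣ ℚ.+ 1ℚ ∎
    where open +-*-Solver

  *-close : ∀ a b c d K L δ → 0ℚ ℚ.≤ K → 0ℚ ℚ.≤ L →
    ∣ a ∣ ℚ.≤ K → ∣ d ∣ ℚ.≤ L → ∣ a ℚ.- c ∣ ℚ.≤ δ → ∣ b ℚ.- d ∣ ℚ.≤ δ →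
    ∣ a ℚ.* b ℚ.- c ℚ.* d ∣ ℚ.≤ (K ℚ.+ L) ℚ.* δ
  *-close a b c d K L δ 0≤K 0≤L a≤K d≤L a-c≤δ b-d≤δ =
    subst (∣ a ℚ.* b ℚ.- c ℚ.* d ∣ ℚ.≤_) (sym (ℚₚ.*-distribʳ-+ δ K L))
      (subst (λ z → ∣ z ∣ ℚ.≤ K ℚ.* δ ℚ.+ L ℚ.* δ) (sym (rearrange a b c d))
        (ℚₚ.≤-trans
          (ℚₚ.∣p+q∣≤∣p∣+∣q∣ (a ℚ.* (b ℚ.- d)) (d ℚ.* (a ℚ.- c)))
          (ℚₚ.+-mono-≤ (product a (b ℚ.- d) K 0≤K a≤K b-d≤δ)
                       (product d (a ℚ.- c) L 0≤L d≤L a-c≤δ))))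
    where
    open +-*-Solver
    rearrange : ∀ a b c d →
      a ℚ.* b ℚ.- c ℚ.* d ≡ a ℚ.* (b ℚ.- d) ℚ.+ d ℚ.* (a ℚ.- c)
    rearrange = solve 4
      (λ a b c d → a :* b :- c :* d := a :* (b :- d) :+ d :* (a :- c)) refl

    product : ∀ p q M → 0ℚ ℚ.≤ M → ∣ p ∣ ℚ.≤ M → ∣ q ∣ ℚ.≤ δ →
              ∣ p ℚ.* q ∣ ℚ.≤ M ℚ.* δ
    product p q M 0≤M p≤M q≤δ = subst (ℚ._≤ M ℚ.* δ)
      (sym (ℚₚ.∣p*q∣≡∣p∣*∣q∣ p q))
      (*-mono-≤ {∣ p ∣} {M} {∣ q ∣} {δ} (ℚₚ.0≤∣p∣ q) 0≤M p≤M q≤δ)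

  *-cauchy : ∀ s t → IsCauchy s → IsCauchy t → IsCauchy (λ n → s n ℚ.* t n)
  *-cauchy s t cs ct ε 0<ε =
      let (K , 0<K , P , hP) = bounded s cs
          (L , 0<L , Q , hQ) = bounded t ct
          (δ , 0<δ , K+L*δ≡ε) =
            divide (K ℚ.+ L) ε (ℚₚ.+-mono-< 0<K 0<L) 0<ε
          (S , hS) = cs δ 0<δ
          (T , hT) = ct δ 0<δ
      in
      (P ℕ.⊔ Q) ℕ.⊔ (S ℕ.⊔ T) , λ m n p q →
      let (P≤m , _   , S≤m , T≤m) = ⊔₄≤ P Q S T p
          (_   , Q≤n , S≤n , T≤n) = ⊔₄≤ P Q S T q
      in
      subst (∣ s m ℚ.* t m ℚ.- s n ℚ.* t n ∣ ℚ.≤_) K+L*δ≡ε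
        (*-close (s m) (t m) (s n) (t n) K L δ (ℚₚ.<⇒≤ 0<K) (ℚₚ.<⇒≤ 0<L)
          (hP m P≤m) (hQ n Q≤n) (hS m n S≤m S≤n) (hT m n T≤m T≤n))
    where
    ⊔₄≤ : ∀ P Q S T {n} → (P ℕ.⊔ Q) ℕ.⊔ (S ℕ.⊔ T) ℕ.≤ n →
          P ℕ.≤ n × Q ℕ.≤ n × S ℕ.≤ n × T ℕ.≤ n
    ⊔₄≤ P Q S T h =
      let PQ≤ = ℕₚ.m⊔n≤o⇒m≤o (P ℕ.⊔ Q) (S ℕ.⊔ T) h
          ST≤ = ℕₚ.m⊔n≤o⇒n≤o (P ℕ.⊔ Q) (S ℕ.⊔ T) h
      in ℕₚ.m⊔n≤o⇒m≤o P Q PQ≤ , ℕₚ.m⊔n≤o⇒n≤o P Q PQ≤ ,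
         ℕₚ.m⊔n≤o⇒m≤o S T ST≤ , ℕₚ.m⊔n≤o⇒n≤o S T ST≤

infixl 6 _+_ _-_
infixl 7 _*_
infix  8 -_

_+_ : ℝ → ℝ → ℝ
x + y = mkℝ (λ n → seq x n ℚ.+ seq y n)
  (+-cauchy (seq x) (seq y) (cauchy x) (cauchy y))

-_ : ℝ → ℝ
- x = mkℝ (λ n → ℚ.- seq x n) (neg-cauchy (seq x) (cauchy x))

_-_ : ℝ → ℝ → ℝ
x - y = x + (- y)

_*_ : ℝ → ℝ → ℝ
x * y = mkℝ (λ n → seq x n ℚ.* seq y n)
  (*-cauchy (seq x) (seq y) (cauchy x) (cauchy y))

-- climb e q k is the largest j * e with j ≤ k and (j * e)² ≤ q
-- (and 0 when q < 0).
climb : ℚ → ℚ → ℕ → ℚ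
climb e q zero    = 0ℚ
climb e q (suc k) with climb e q k
... | a with (a ℚ.+ e) ℚ.* (a ℚ.+ e) ℚ.≤? q
...   | yes _ = a ℚ.+ e
...   | no  _ = a

step : ℕ → ℚ
step n = ℚ.mkℚ (+ 1) n (Coprime.1-coprimeTo (suc n))

-- Enough steps of size 1/(n+1) to reach the natural number |↥q| + 1,
-- whose square exceeds q.
steps : ℕ → ℚ → ℕ
steps n q = suc ℤ.∣ ℚ.↥ q ∣ ℕ.* suc n

-- The largest multiple of 1/(n+1) whose square is at most q
-- (and 0 when q < 0).
root : ℕ → ℚ → ℚ
root n q = climb (step n) q (steps n q)

private
  fromℕ : ℕ → ℚ
  fromℕ k = ℚ.mkℚ (+ k) 0 (Coprime.sym (Coprime.1-coprimeTo k))

  fromℕ-suc : ∀ k → fromℕ (suc k) ≡ fromℕ k ℚ.+ 1ℚ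
  fromℕ-suc k = ℚₚ.toℚᵘ-injective (begin
    ℚᵘ.mkℚᵘ (+ suc k) 0
      ≈⟨ ℚᵘ.*≡* (cong (ℤ._* + 1) (trans (cong +_ (ℕₚ.+-comm 1 k))
           (cong (ℤ._+ + 1) (sym (ℤₚ.*-identityʳ (+ k)))))) ⟩
    ℚᵘ.mkℚᵘ (+ k) 0 ℚᵘ.+ ℚ.toℚᵘ 1ℚ
      ≈⟨ ℚᵘₚ.≃-sym (ℚₚ.toℚᵘ-homo-+ (fromℕ k) 1ℚ) ⟩
    ℚ.toℚᵘ (fromℕ k ℚ.+ 1ℚ) ∎)
    where
    open import Relation.Binary.Reasoning.Setoid ℚᵘₚ.≃-setoid

  fromℕ*step : ∀ c n → fromℕ (c ℕ.* suc n) ℚ.* step n ≡ fromℕ c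
  fromℕ*step c n = ℚₚ.toℚᵘ-injective (begin
    ℚ.toℚᵘ (fromℕ (c ℕ.* suc n) ℚ.* step n)
      ≈⟨ ℚₚ.toℚᵘ-homo-* (fromℕ (c ℕ.* suc n)) (step n) ⟩
    ℚᵘ.mkℚᵘ (+ (c ℕ.* suc n)) 0 ℚᵘ.* ℚᵘ.mkℚᵘ (+ 1) n
      ≈⟨ ℚᵘ.*≡* (trans (ℤₚ.*-identityʳ _) (trans (ℤₚ.*-identityʳ _)
           (trans (ℤₚ.pos-* c (suc n))
             (cong (λ k → + c ℤ.* + suc k) (sym (ℕₚ.+-identityʳ n)))))) ⟩
    ℚ.toℚᵘ (fromℕ c) ∎)
    where
    open import Relation.Binary.Reasoning.Setoid ℚᵘₚ.≃-setoid

  0≤fromℕ : ∀ c → 0ℚ ℚ.≤ fromℕ c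
  0≤fromℕ c = ℚₚ.nonNegative⁻¹ (fromℕ c)

  0<step : ∀ n → 0ℚ ℚ.< step n
  0<step n = ℚₚ.positive⁻¹ (step n)

  <fromℕ : ∀ q → q ℚ.< fromℕ (suc ℤ.∣ ℚ.↥ q ∣)
  <fromℕ q = ℚₚ.toℚᵘ-cancel-< (bound q)
    where
    i<suc∣i∣ : ∀ i → i ℤ.< + suc ℤ.∣ i ∣
    i<suc∣i∣ (+ n)        = ℤ.+<+ ℕₚ.≤-refl
    i<suc∣i∣ (ℤ.-[1+ n ]) = ℤ.-<+

    bound : ∀ q → ℚ.toℚᵘ q ℚᵘ.< ℚᵘ.mkℚᵘ (+ suc ℤ.∣ ℚ.↥ q ∣) 0
    bound (ℚ.mkℚ i d _) = ℚᵘ.*<* (ℤₚ.<-≤-trans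
      (subst (ℤ._< + suc ℤ.∣ i ∣) (sym (ℤₚ.*-identityʳ i)) (i<suc∣i∣ i))
      (ℤ.+≤+ (ℕₚ.m≤m*n (suc ℤ.∣ i ∣) (suc d))))

  step≤ : ∀ {δ} → 0ℚ ℚ.< δ → ∀ n → ℚ.↧ₙ δ ℕ.≤ n → step n ℚ.≤ δ
  step≤ {δ} 0<δ n h = ℚₚ.toℚᵘ-cancel-≤ (bound δ (ℚ.positive 0<δ) h)
    where
    bound : ∀ δ → ℚ.Positive δ → ℚ.↧ₙ δ ℕ.≤ n → ℚᵘ.mkℚᵘ (+ 1) n ℚᵘ.≤ ℚ.toℚᵘ δ
    bound (ℚ.mkℚ ℤ.+[1+ p ] d _) _ h = ℚᵘ.*≤* (ℤ.+≤+ (ℕₚ.≤-trans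
      (ℕₚ.≤-reflexive (ℕₚ.*-identityˡ (suc d)))
      (ℕₚ.≤-trans (ℕₚ.m≤n⇒m≤1+n h) (ℕₚ.m≤n*m (suc n) (suc p)))))

  climb-spec : ∀ e q k → 0ℚ ℚ.< e → let a = climb e q k in
    0ℚ ℚ.≤ a × (a ≡ 0ℚ ⊎ a ℚ.* a ℚ.≤ q) ×
    (a ≡ fromℕ k ℚ.* e ⊎ q ℚ.< (a ℚ.+ e) ℚ.* (a ℚ.+ e))
  climb-spec e q zero 0<e =
    ℚₚ.≤-refl , inj₁ refl , inj₁ (sym (ℚₚ.*-zeroˡ e))
  climb-spec e q (suc k) 0<e with climb e q k | climb-spec e q k 0<e
  ... | a | 0≤a , below , above with (a ℚ.+ e) ℚ.* (a ℚ.+ e) ℚ.≤? q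
  ...   | no  ≰q = 0≤a , below , inj₂ (ℚₚ.≰⇒> ≰q)
  ...   | yes ≤q = ℚₚ.+-mono-≤ 0≤a (ℚₚ.<⇒≤ 0<e) , inj₂ ≤q , next above
    where
    open +-*-Solver
    next : (a ≡ fromℕ k ℚ.* e ⊎ q ℚ.< (a ℚ.+ e) ℚ.* (a ℚ.+ e)) →
      (a ℚ.+ e ≡ fromℕ (suc k) ℚ.* e ⊎
       q ℚ.< ((a ℚ.+ e) ℚ.+ e) ℚ.* ((a ℚ.+ e) ℚ.+ e))
    next (inj₁ a≡) = inj₁ (trans (cong (ℚ._+ e) a≡) (trans
      (solve 2 (λ x y → x :* y :+ y := (x :+ con 1ℚ) :* y) refl (fromℕ k) e)
      (cong (ℚ._* e) (sym (fromℕ-suc k)))))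
    next (inj₂ q<) = contradiction ≤q (<⇒≱ q<)

root-spec : ∀ n q → let a = root n q in
  0ℚ ℚ.≤ a × (a ≡ 0ℚ ⊎ a ℚ.* a ℚ.≤ q) × q ℚ.< (a ℚ.+ step n) ℚ.* (a ℚ.+ step n)
root-spec n q with climb-spec (step n) q (steps n q) (0<step n)
... | 0≤a , below , inj₂ q<      = 0≤a , below , q<
... | 0≤a , below , inj₁ a≡ = 0≤a , below , ℚₚ.<-≤-trans q<c*c
    (*-mono-≤ 0≤c (ℚₚ.≤-trans 0≤c c≤a+e) c≤a+e c≤a+e)
  where
  c = fromℕ (suc ℤ.∣ ℚ.↥ q ∣)

  0≤c : 0ℚ ℚ.≤ c
  0≤c = 0≤fromℕ (suc ℤ.∣ ℚ.↥ q ∣)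

  1≤c : 1ℚ ℚ.≤ c
  1≤c = subst (1ℚ ℚ.≤_) (sym (fromℕ-suc ℤ.∣ ℚ.↥ q ∣))
    (ℚₚ.+-mono-≤ (0≤fromℕ ℤ.∣ ℚ.↥ q ∣) (ℚₚ.≤-refl {1ℚ}))

  q<c*c : q ℚ.< c ℚ.* c
  q<c*c = ℚₚ.<-≤-trans (<fromℕ q) (subst (ℚ._≤ c ℚ.* c) (ℚₚ.*-identityˡ c)
    (*-mono-≤ 0≤c 0≤c 1≤c ℚₚ.≤-refl))

  c≤a+e : c ℚ.≤ root n q ℚ.+ step n
  c≤a+e = subst (ℚ._≤ root n q ℚ.+ step n)
    (trans (ℚₚ.+-identityʳ (root n q))
      (trans a≡ (fromℕ*step (suc ℤ.∣ ℚ.↥ q ∣) n)))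
    (ℚₚ.+-monoʳ-≤ (root n q) (ℚₚ.<⇒≤ (0<step n)))

private
  root-close : ∀ {δ q q'} m n → 0ℚ ℚ.< δ → step n ℚ.≤ δ →
    q ℚ.≤ q' ℚ.+ δ ℚ.* δ → root m q ℚ.≤ root n q' ℚ.+ (δ ℚ.+ δ)
  root-close {δ} {q} {q'} m n 0<δ e≤δ q≤ =
    ℚₚ.≮⇒≥ λ gap → absurd gap (proj₁ (proj₂ (root-spec m q)))
    where
    open +-*-Solver
    a = root m q
    b = root n q'
    e = step n
    0≤b = proj₁ (root-spec n q')
    0≤δ = ℚₚ.<⇒≤ 0<δ
    0≤b+e : 0ℚ ℚ.≤ b ℚ.+ e
    0≤b+e = ℚₚ.+-mono-≤ 0≤b (ℚₚ.<⇒≤ (0<step n))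

    absurd : b ℚ.+ (δ ℚ.+ δ) ℚ.< a → ¬ (a ≡ 0ℚ ⊎ a ℚ.* a ℚ.≤ q)
    absurd gap (inj₁ a≡0) = <⇒≱ gap (subst (ℚ._≤ b ℚ.+ (δ ℚ.+ δ))
      (sym a≡0) (ℚₚ.+-mono-≤ 0≤b (ℚₚ.+-mono-≤ 0≤δ 0≤δ)))
    absurd gap (inj₂ a²≤q) = ℚₚ.<-irrefl refl (begin-strict
      q                                         ≤⟨ q≤ ⟩
      q' ℚ.+ δ ℚ.* δ
        <⟨ ℚₚ.+-monoˡ-< (δ ℚ.* δ) (proj₂ (proj₂ (root-spec n q'))) ⟩
      (b ℚ.+ e) ℚ.* (b ℚ.+ e) ℚ.+ δ ℚ.* δ
        ≡⟨ sym (ℚₚ.+-identityʳ _) ⟩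
      (b ℚ.+ e) ℚ.* (b ℚ.+ e) ℚ.+ δ ℚ.* δ ℚ.+ 0ℚ
        ≤⟨ ℚₚ.+-monoʳ-≤ ((b ℚ.+ e) ℚ.* (b ℚ.+ e) ℚ.+ δ ℚ.* δ)
             (ℚₚ.+-mono-≤ 0≤x 0≤x) ⟩
      (b ℚ.+ e) ℚ.* (b ℚ.+ e) ℚ.+ δ ℚ.* δ ℚ.+ (x ℚ.+ x)
        ≡⟨ solve 2 (λ c d → c :* c :+ d :* d :+ (c :* d :+ c :* d)
                            := (c :+ d) :* (c :+ d)) refl (b ℚ.+ e) δ ⟩
      (b ℚ.+ e ℚ.+ δ) ℚ.* (b ℚ.+ e ℚ.+ δ)
        ≤⟨ *-mono-≤ 0≤c (ℚₚ.≤-trans 0≤c c≤a) c≤a c≤a ⟩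
      a ℚ.* a                                   ≤⟨ a²≤q ⟩
      q                                         ∎)
      where
      open ℚₚ.≤-Reasoning
      x = (b ℚ.+ e) ℚ.* δ
      0≤x : 0ℚ ℚ.≤ x
      0≤x = subst (ℚ._≤ x) (ℚₚ.*-zeroˡ δ)
        (ℚₚ.*-monoʳ-≤-nonNeg δ {{ℚ.nonNegative 0≤δ}} 0≤b+e)
      0≤c : 0ℚ ℚ.≤ b ℚ.+ e ℚ.+ δ
      0≤c = ℚₚ.+-mono-≤ 0≤b+e 0≤δ
      c≤a : b ℚ.+ e ℚ.+ δ ℚ.≤ a
      c≤a = ℚₚ.≤-trans (subst (ℚ._≤ b ℚ.+ (δ ℚ.+ δ))
        (sym (ℚₚ.+-assoc b e δ)) (ℚₚ.+-monoʳ-≤ b (ℚₚ.+-monoˡ-≤ δ e≤δ)))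
        (ℚₚ.<⇒≤ gap)

  root-cauchy : ∀ s → IsCauchy s → IsCauchy (λ n → root n (s n))
  root-cauchy s cs ε 0<ε = N ℕ.⊔ D , λ m n p q → ≤+⇒∣-∣≤
    (close m n (D≤ q) (hN m n (N≤ p) (N≤ q)))
    (close n m (D≤ p) (hN n m (N≤ q) (N≤ p)))
    where
    δ = ½ ℚ.* ε
    0<δ = half-pos 0<ε
    N  = proj₁ (cs (δ ℚ.* δ) (pos*pos 0<δ 0<δ))
    hN = proj₂ (cs (δ ℚ.* δ) (pos*pos 0<δ 0<δ))
    D = ℚ.↧ₙ δ
    N≤ : ∀ {n} → N ℕ.⊔ D ℕ.≤ n → N ℕ.≤ n
    N≤ = ℕₚ.m⊔n≤o⇒m≤o N D
    D≤ : ∀ {n} → N ℕ.⊔ D ℕ.≤ n → D ℕ.≤ n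
    D≤ = ℕₚ.m⊔n≤o⇒n≤o N D
    close : ∀ m n → D ℕ.≤ n → ∣ s m ℚ.- s n ∣ ℚ.≤ δ ℚ.* δ →
            root m (s m) ℚ.≤ root n (s n) ℚ.+ ε
    close m n d h = subst (λ z → root m (s m) ℚ.≤ root n (s n) ℚ.+ z)
      (half+half ε)
      (root-close m n 0<δ (step≤ 0<δ n d) (∣-∣≤⇒≤+ h))

-- The termwise root approximations converge; the value is 0 for x ≤ 0.
√ : ℝ → ℝ
√ x = mkℝ (λ n → root n (seq x n)) (root-cauchy (seq x) (cauchy x))

ℝ^ : ℕ → Set
ℝ^ n = Vector ℝ n

infix 4 _≈ᵛ_

_≈ᵛ_ : ∀ {n} → ℝ^ n → ℝ^ n → Set
v ≈ᵛ w = ∀ i → v i ≈ w i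

‖_‖ : ∀ {n} → ℝ^ n → ℝ
‖ v ‖ = √ (foldr (λ a s → a * a + s) 0ℝ v)

dist : ∀ {n} → ℝ^ n → ℝ^ n → ℝ
dist v w = ‖ (λ i → v i - w i) ‖

-- A finite set of size k is enumerated without repetition by Fin k, so
-- functions out of Fin k are exactly functions on the set of points.
record FiniteSet (n : ℕ) : Set where
  field
    size     : ℕ
    point    : Fin size → ℝ^ n
    distinct : ∀ {i j} → point i ≈ᵛ point j → i ≡ j

open FiniteSet public

infix 4 _∈_ _⊆_

_∈_ : ∀ {n} → ℝ^ n → FiniteSet n → Set
v ∈ P = ∃[ i ] v ≈ᵛ point P i

_⊆_ : ∀ {n} → FiniteSet n → FiniteSet n → Set
P ⊆ Q = ∀ i → point P i ∈ Q

Congruent : ∀ {m n} → FiniteSet m → FiniteSet n → Set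
Congruent P Q = Σ (Fin (size P) ⤖ Fin (size Q)) λ f →
  let open Bijection f in
  ∀ i j → dist (point Q (to i)) (point Q (to j)) ≈ dist (point P i) (point P j)

IsSupremum : Pred ℝ 0ℓ → ℝ → Set
IsSupremum S s =
  (∀ t → S t → t ≤ s) × (∀ u → (∀ t → S t → t ≤ u) → s ≤ u)

IsMinimum : Pred ℝ 0ℓ → ℝ → Set
IsMinimum S s = S s × (∀ t → S t → s ≤ t)

IsDiameter : ∀ {n} → FiniteSet n → ℝ → Set
IsDiameter P = IsSupremum λ t →
  ∃[ i ] ∃[ j ] t ≈ dist (point P i) (point P j)

LiesOnSphereOfRadius : ∀ {n} → FiniteSet n → ℝ → Set
LiesOnSphereOfRadius {n} P ρ =
  0ℝ ≤ ρ × Σ (ℝ^ n) λ c → ∀ i → dist (point P i) c ≈ ρ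

Spherical : ∀ {n} → FiniteSet n → Set
Spherical P = ∃ (LiesOnSphereOfRadius P)

IsCircumradius : ∀ {n} → FiniteSet n → ℝ → Set
IsCircumradius P = IsMinimum (LiesOnSphereOfRadius P)

Colouring : ∀ {n} → FiniteSet n → ℕ → Set
Colouring B r = Fin (size B) → Fin r

Monochromatic : ∀ {n r} (B : FiniteSet n) → Colouring B r → FiniteSet n → Set
Monochromatic B χ P = ∀ i j → point B i ∈ P → point B j ∈ P → χ i ≡ χ j

DiameterRamsey : ∀ {d} → FiniteSet d → Set
DiameterRamsey A = ∀ r → ℕ.NonZero r →
  ∃[ n ] ℕ.NonZero n × Σ (FiniteSet n) λ B →
    (∃[ δ ] IsDiameter A δ × IsDiameter B δ) ×
    ((χ : Colouring B r) → Σ (FiniteSet n) λ A' →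
      A' ⊆ B × Monochromatic B χ A' × Congruent A' A)

{-# OPTIONS --safe #-}
module Submission where

-- A set B of diameter δ lies in a ball of radius about δ/√2, around some z
-- (Jung). Colour the points of B by thin shells around z; the number of shells
-- does not depend on B. Write the circumcentre of A as an affine combination
-- Σ λᵢ aᵢ. For an isometric copy x of A, the sum Σ λᵢ |xᵢ - z|² is at least the
-- squared circumradius, because Σ λᵢ λⱼ |xᵢ - xⱼ|² is an isometry invariant. If x
-- lies in one thin shell, that sum is close to |x₀ - z|², hence at most about δ²/2.

open import Algebra.Bundles using (CommutativeRing)
open import Algebra.Solver.Ring.AlmostCommutativeRing
  using (fromCommutativeRing; _-Raw-AlmostCommutative⟶_; Induced-equivalence)
import Algebra.Solver.Ring as RingSolver
open import Algebra.Structures using (IsCommutativeRing)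
open import Data.Empty using (⊥)
open import Data.Fin.Base using (Fin; zero; suc; toℕ)
open import Data.Fin.Properties using (sequence)
open import Data.Integer.Base as ℤ using (+_)
import Data.Integer.Properties as ℤₚ
open import Data.Maybe.Base using (map)
open import Data.Nat.Base as ℕ using (ℕ; zero; suc; NonZero)
import Data.Nat.Properties as ℕₚ
open import Data.Product using (∃; ∃-syntax; _×_; _,_; proj₁; proj₂)
open import Data.Rational as ℚ using (ℚ; 0ℚ; 1ℚ; ½; ∣_∣)
import Data.Rational.Properties as ℚₚ
open import Data.Rational.Solver using (module +-*-Solver)
import Data.Rational.Unnormalised as ℚᵘ
import Data.Rational.Unnormalised.Properties as ℚᵘₚ
open import Data.Sum.Base using (inj₁; inj₂)
open import Data.Vec.Functional using (Vector; head; tail; foldr; _∷_)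
open import Effect.Monad using (RawMonad)
open import Function.Base using (_∘_)
open import Function.Bundles using (module Bijection)
open import Level using (0ℓ)
open import Relation.Binary.Bundles using (Poset)
open import Relation.Binary.Consequences using (dec⇒weaklyDec)
open import Relation.Binary.Definitions using (WeaklyDecidable)
open import Relation.Binary.PropositionalEquality using (_≡_; cong; subst)
open import Relation.Binary.Structures using (IsPartialOrder)
open import Relation.Nullary using (¬_; Dec; yes; no; contradiction)
open import Relation.Nullary.Decidable using (¬¬-excluded-middle; decidable-stable)
open import Relation.Nullary.Negation using (¬¬-Monad)

-- The goal is a negation, and this shapes the proof. For Cauchy reals one cannot decide a
-- comparison, invert a number not known to be apart from 0, project onto a span or choose a shell.
-- All of this is possible under double negation, which may be removed on the way to a
-- contradiction.
--
-- The radius δ/√2 has to be free of the dimension, as `B` may live in any space. It comes from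
-- variances: a probability distribution on points at mutual distance at most δ has variance f with
-- 2f ≤ δ². A mean of nearly maximal variance is a good centre, and finitely many steps reach one;
-- the price is a small slack `η` in the radius, in place of a compactness argument for the smallest
-- ball.
--
-- The hypothesis on A forces some λᵢ to be negative: with nonnegative weights, Σ λᵢ λⱼ |aᵢ - aⱼ|²,
-- which is twice the squared radius, would be at most δ². Hence upper bounds on the |xᵢ - z|² alone
-- do not bound their weighted sum. A thin shell confines them from both sides, and the error is its
-- thickness times a constant of the weights.

fromℕ : ℕ → ℚ
fromℕ zero    = 0ℚ
fromℕ (suc n) = 1ℚ ℚ.+ fromℕ n

-- An Archimedean ordered field as it exists constructively: comparison and
-- inversion are available only under double negation.
record ArchimedeanField : Set₁ where
  infix  4 _≈_ _≤_
  infixl 6 _+_ _-_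
  infixl 7 _*_
  infix  8 -_
  field
    Carrier           : Set
    _≈_ _≤_           : Carrier → Carrier → Set
    _+_ _*_           : Carrier → Carrier → Carrier
    -_                : Carrier → Carrier
    ι                 : ℚ → Carrier
    isCommutativeRing : IsCommutativeRing _≈_ _+_ _*_ -_ (ι 0ℚ) (ι 1ℚ)
    ι-+               : ∀ p q → ι (p ℚ.+ q) ≈ ι p + ι q
    ι-*               : ∀ p q → ι (p ℚ.* q) ≈ ι p * ι q
    ι-neg             : ∀ p → ι (ℚ.- p) ≈ - ι p
    isPartialOrder    : IsPartialOrder _≈_ _≤_
    +-mono-≤          : ∀ {w x y z} → w ≤ x → y ≤ z → w + y ≤ x + z
    *-nonNeg          : ∀ {x y} → ι 0ℚ ≤ x → ι 0ℚ ≤ y → ι 0ℚ ≤ x * y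
    ≤-stable          : ∀ {x y} → ¬ ¬ x ≤ y → x ≤ y
    ≰⇒≥               : ∀ {x y} → ¬ x ≤ y → y ≤ x
    archimedean       : ∀ x → ∃[ n ] x ≤ ι (fromℕ n)
    inverse           : ∀ {x} → ¬ x ≤ ι 0ℚ → ¬ ¬ (∃[ y ] y * x ≈ ι 1ℚ)

  _-_ : Carrier → Carrier → Carrier
  x - y = x + - y

module Geometry (F : ArchimedeanField) where

  open ArchimedeanField F

  commutativeRing : CommutativeRing 0ℓ 0ℓ
  commutativeRing = record { isCommutativeRing = isCommutativeRing }

  open CommutativeRing commutativeRing public
    using (refl; sym; trans; +-cong; *-cong; -‿cong)

  -- The ring solver computes with coefficients in ℚ, where equality is decidable; the field offers
  -- no such decision.
  rational-coefficients :
    CommutativeRing.rawRing ℚₚ.+-*-commutativeRing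
      -Raw-AlmostCommutative⟶ fromCommutativeRing commutativeRing
  rational-coefficients = record
    { ⟦_⟧    = ι
    ; +-homo = ι-+
    ; *-homo = ι-*
    ; -‿homo = ι-neg
    ; 0-homo = refl
    ; 1-homo = refl
    }

  _coeff≟_ : WeaklyDecidable (Induced-equivalence rational-coefficients)
  p coeff≟ q = map (λ { p≡q → CommutativeRing.reflexive commutativeRing (cong ι p≡q) })
                   (dec⇒weaklyDec ℚₚ._≟_ p q)

  open RingSolver (CommutativeRing.rawRing ℚₚ.+-*-commutativeRing)
    (fromCommutativeRing commutativeRing) rational-coefficients _coeff≟_

  open IsPartialOrder isPartialOrder public using (antisym)
    renaming (reflexive to ≤-reflexive; refl to ≤-refl; trans to ≤-trans)

  poset : Poset 0ℓ 0ℓ 0ℓ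
  poset = record { isPartialOrder = isPartialOrder }

  open import Relation.Binary.Reasoning.PartialOrder poset

  0F 1F : Carrier
  0F = ι 0ℚ
  1F = ι 1ℚ

  -- Ordered fields

  +-nonNeg : ∀ {x y} → 0F ≤ x → 0F ≤ y → 0F ≤ x + y
  +-nonNeg {x} {y} 0≤x 0≤y = ≤-trans
    (≤-reflexive (solve 0 (con 0ℚ := con 0ℚ :+ con 0ℚ) refl)) (+-mono-≤ 0≤x 0≤y)

  ≤⇒0≤- : ∀ {x y} → x ≤ y → 0F ≤ y - x
  ≤⇒0≤- {x} {y} x≤y = begin
    0F    ≈⟨ solve 1 (λ x → con 0ℚ := x :- x) refl x ⟩
    x - x ≤⟨ +-mono-≤ x≤y ≤-refl ⟩
    y - x ∎

  ≤-by : ∀ {x y} r → 0F ≤ r → y ≈ x + r → x ≤ y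
  ≤-by {x} {y} r 0≤r y≈x+r = begin
    x      ≈⟨ solve 1 (λ x → x := x :+ con 0ℚ) refl x ⟩
    x + 0F ≤⟨ +-mono-≤ ≤-refl 0≤r ⟩
    x + r  ≈⟨ y≈x+r ⟨
    y      ∎

  *-monoˡ-≤ : ∀ {x y} z → 0F ≤ z → x ≤ y → z * x ≤ z * y
  *-monoˡ-≤ {x} {y} z 0≤z x≤y = ≤-by (z * (y - x)) (*-nonNeg 0≤z (≤⇒0≤- x≤y))
    (solve 3 (λ x y z → z :* y := z :* x :+ z :* (y :- x)) refl x y z)

  square-nonNeg : ∀ x → 0F ≤ x * x
  square-nonNeg x = ≤-stable λ ¬0≤x² → ¬0≤x² (≤-trans
    (let 0≤-x = ≤⇒0≤- (≰⇒≥ λ 0≤x → ¬0≤x² (*-nonNeg 0≤x 0≤x)) in *-nonNeg 0≤-x 0≤-x)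
    (≤-reflexive (solve 1 (λ x → (con 0ℚ :- x) :* (con 0ℚ :- x) := x :* x) refl x)))

  0≤1 : 0F ≤ 1F
  0≤1 = ≤-trans (square-nonNeg 1F)
    (≤-reflexive (solve 0 (con 1ℚ :* con 1ℚ := con 1ℚ) refl))

  inverse-nonNeg : ∀ {x y} → y * x ≈ 1F → 0F ≤ x → 0F ≤ y
  inverse-nonNeg {x} {y} yx≈1 0≤x = begin
    0F          ≤⟨ *-nonNeg (square-nonNeg y) 0≤x ⟩
    y * y * x   ≈⟨ solve 2 (λ x y → y :* y :* x := y :* (y :* x)) refl x y ⟩
    y * (y * x) ≈⟨ *-cong refl yx≈1 ⟩
    y * 1F      ≈⟨ solve 1 (λ y → y :* con 1ℚ := y) refl y ⟩
    y           ∎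

  -- Strict positivity is coded as `¬ x ≤ 0F`, the form that `inverse` accepts. The proof divides
  -- `x * y ≤ 0F` by `x`.
  *-pos : ∀ {x y} → ¬ x ≤ 0F → ¬ y ≤ 0F → ¬ x * y ≤ 0F
  *-pos {x} {y} x>0 y>0 xy≤0 = inverse x>0 λ { (v , vx≈1) → y>0 (begin
    y           ≈⟨ solve 1 (λ y → y := con 1ℚ :* y) refl y ⟩
    1F * y      ≈⟨ *-cong vx≈1 refl ⟨
    v * x * y   ≈⟨ solve 3 (λ v x y → v :* x :* y := v :* (x :* y)) refl v x y ⟩
    v * (x * y) ≤⟨ *-monoˡ-≤ v (inverse-nonNeg vx≈1 (≰⇒≥ x>0)) xy≤0 ⟩
    v * 0F      ≈⟨ solve 1 (λ v → v :* con 0ℚ := con 0ℚ) refl v ⟩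
    0F          ∎) }

  >⇒0<- : ∀ {x y} → ¬ y ≤ x → ¬ y - x ≤ 0F
  >⇒0<- {x} {y} x<y y-x≤0 = x<y (≤-by (0F - (y - x)) (≤⇒0≤- y-x≤0)
    (solve 2 (λ x y → x := y :+ (con 0ℚ :- (y :- x))) refl x y))

  -- If `x` exceeded `y`, both `x - y` and `x + y` would be positive, and so would their product
  -- `x² - y²`.
  square-cancel-≤ : ∀ {x y} → 0F ≤ y → x * x ≤ y * y → x ≤ y
  square-cancel-≤ {x} {y} 0≤y x²≤y² = ≤-stable λ x≰y →
    *-pos (>⇒0<- x≰y)
      (λ x+y≤0 → >⇒0<- x≰y (≤-trans (≤-by (y + y) (+-nonNeg 0≤y 0≤y)
        (solve 2 (λ x y → x :+ y := (x :- y) :+ (y :+ y)) refl x y)) x+y≤0))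
      (≤-by (y * y - x * x) (≤⇒0≤- x²≤y²) (solve 2
        (λ x y → con 0ℚ := (x :- y) :* (x :+ y) :+ (y :* y :- x :* x)) refl x y))

  square-mono-≤ : ∀ {x y} → 0F ≤ x → x ≤ y → x * x ≤ y * y
  square-mono-≤ {x} {y} 0≤x x≤y = ≤-by ((y - x) * (y + x))
    (*-nonNeg (≤⇒0≤- x≤y) (+-nonNeg (≤-trans 0≤x x≤y) 0≤x))
    (solve 2 (λ x y → y :* y := x :* x :+ (y :- x) :* (y :+ x)) refl x y)

  -- Here `h` stands for √½, the factor in the hypothesis on the circumradius.
  half-square : ∀ {x y h} → h * h ≈ ι ½ → 0F ≤ ι ½ → x + x ≤ y * y →
    x ≤ (y * h) * (y * h)
  half-square {x} {y} {h} h²≈½ 0≤½ 2x≤y² = begin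
    x                   ≈⟨ solve 1 (λ x → x := con ½ :* (x :+ x)) refl x ⟩
    ι ½ * (x + x)       ≤⟨ *-monoˡ-≤ (ι ½) 0≤½ 2x≤y² ⟩
    ι ½ * (y * y)       ≈⟨ *-cong h²≈½ refl ⟨
    (h * h) * (y * y)   ≈⟨ solve 2 (λ h y → (h :* h) :* (y :* y)
                                      := (y :* h) :* (y :* h)) refl h y ⟩
    (y * h) * (y * h)   ∎

  -- Source of every small parameter: the step length towards a far point, the slack of the
  -- enclosing ball and the thickness of the shells. The bound `t≤1` serves the first, keeping the
  -- new centre a convex combination.
  record Small (x e : Carrier) : Set where
    field
      t     : Carrier
      t>0   : ¬ t ≤ 0F
      t≤1   : t ≤ 1F
      2tx≤e : t * x + t * x ≤ e

    t≥0 : 0F ≤ t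
    t≥0 = ≰⇒≥ t>0

  -- t = e / (e + x² + 1) is small enough because 2x ≤ x² + 1.
  small : ∀ x {e} → ¬ e ≤ 0F → ¬ ¬ Small x e
  small x {e} e>0 k = inverse u>0 λ { (v , vu≈1) →
    let 0≤v  = inverse-nonNeg vu≈1 (≰⇒≥ u>0)
        0≤ev = *-nonNeg 0≤e 0≤v
        evu≈e : e * v * u ≈ e
        evu≈e = trans (solve 3 (λ e v u → e :* v :* u := e :* (v :* u)) refl e v u)
          (trans (*-cong refl vu≈1) (solve 1 (λ e → e :* con 1ℚ := e) refl e))
    in k (record
      { t     = e * v
      ; t>0   = λ ev≤0 → e>0 (begin
          e              ≈⟨ evu≈e ⟨
          e * v * u      ≈⟨ solve 2 (λ t u → t :* u := u :* t) refl (e * v) u ⟩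
          u * (e * v)    ≤⟨ *-monoˡ-≤ u (≰⇒≥ u>0) ev≤0 ⟩
          u * 0F         ≈⟨ solve 1 (λ u → u :* con 0ℚ := con 0ℚ) refl u ⟩
          0F             ∎)
      ; t≤1   = ≤-by (v * (x * x + 1F)) (*-nonNeg 0≤v 0≤x²+1)
          (trans (sym vu≈1) (solve 3 (λ e v x → v :* (e :+ (x :* x :+ con 1ℚ))
            := e :* v :+ v :* (x :* x :+ con 1ℚ)) refl e v x))
      ; 2tx≤e = ≤-by (e * v * (e + (1F - x) * (1F - x)))
          (*-nonNeg 0≤ev (+-nonNeg 0≤e (square-nonNeg _)))
          (trans (sym evu≈e) (solve 3 (λ e v x →
            e :* v :* (e :+ (x :* x :+ con 1ℚ)) := (e :* v :* x :+ e :* v :* x)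
              :+ e :* v :* (e :+ (con 1ℚ :- x) :* (con 1ℚ :- x))) refl e v x))
      }) }
    where
    u = e + (x * x + 1F)
    0≤e = ≰⇒≥ e>0
    0≤x²+1 : 0F ≤ x * x + 1F
    0≤x²+1 = +-nonNeg (square-nonNeg x) 0≤1
    u>0 : ¬ u ≤ 0F
    u>0 u≤0 = e>0 (≤-trans (≤-by _ 0≤x²+1 refl) u≤0)

  archimedean-* : ∀ x {g} → ¬ g ≤ 0F → ¬ ¬ (∃[ n ] x ≤ ι (fromℕ n) * g)
  archimedean-* x {g} g>0 k = inverse g>0 λ { (h , hg≈1) →
    let (n , xh≤n) = archimedean (x * h) in k (n , (begin
      x           ≈⟨ solve 1 (λ x → x := x :* con 1ℚ) refl x ⟩
      x * 1F      ≈⟨ *-cong refl hg≈1 ⟨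
      x * (h * g) ≈⟨ solve 3 (λ x h g → x :* (h :* g) := g :* (x :* h)) refl x h g ⟩
      g * (x * h) ≤⟨ *-monoˡ-≤ g (≰⇒≥ g>0) xh≤n ⟩
      g * ι (fromℕ n) ≈⟨ solve 2 (λ g n → g :* n := n :* g) refl g (ι (fromℕ n)) ⟩
      ι (fromℕ n) * g ∎)) }

  -- Vectors

  infixl 6 _⊖_
  infix  4 _≈ᵛ_

  Vec : ℕ → Set
  Vec = Vector Carrier

  _≈ᵛ_ : ∀ {n} → Vec n → Vec n → Set
  u ≈ᵛ v = ∀ k → u k ≈ v k

  _⊖_ : ∀ {n} → Vec n → Vec n → Vec n
  (u ⊖ v) k = u k - v k

  sum : ∀ {n} → Vec n → Carrier
  sum = foldr _+_ 0F

  dot : ∀ {n} → Vec n → Vec n → Carrier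
  dot u v = sum λ k → u k * v k

  sqDist : ∀ {n} → Vec n → Vec n → Carrier
  sqDist u v = dot (u ⊖ v) (u ⊖ v)

  combination : ∀ {m n} → Vec m → (Fin m → Vec n) → Vec n
  combination μ v k = dot μ λ i → v i k

  dot-cong : ∀ {n} {u u′ v v′ : Vec n} → u ≈ᵛ u′ → v ≈ᵛ v′ → dot u v ≈ dot u′ v′
  dot-cong {zero}  u≈u′ v≈v′ = refl
  dot-cong {suc n} u≈u′ v≈v′ = +-cong (*-cong (u≈u′ zero) (v≈v′ zero))
    (dot-cong (u≈u′ ∘ suc) (v≈v′ ∘ suc))

  dot-comm : ∀ {n} (u v : Vec n) → dot u v ≈ dot v u
  dot-comm {zero}  u v = refl
  dot-comm {suc n} u v = +-cong
    (solve 2 (λ x y → x :* y := y :* x) refl (head u) (head v))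
    (dot-comm (tail u) (tail v))

  -- The shape `p + c * q` has sums, differences and scalings as instances.
  dot-linear : ∀ {n} (w p q : Vec n) c →
    dot w (λ k → p k + c * q k) ≈ dot w p + c * dot w q
  dot-linear {zero}  w p q c =
    solve 1 (λ c → con 0ℚ := con 0ℚ :+ c :* con 0ℚ) refl c
  dot-linear {suc n} w p q c = trans
    (+-cong refl (dot-linear (tail w) (tail p) (tail q) c))
    (solve 6 (λ w p q c d e → w :* (p :+ c :* q) :+ (d :+ c :* e)
      := (w :* p :+ d) :+ c :* (w :* q :+ e)) refl
      (head w) (head p) (head q) c (dot (tail w) (tail p)) (dot (tail w) (tail q)))

  dot-zeroʳ : ∀ {n} (w : Vec n) → dot w (λ _ → 0F) ≈ 0F
  dot-zeroʳ {zero}  w = refl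
  dot-zeroʳ {suc n} w = trans (+-cong refl (dot-zeroʳ (tail w)))
    (solve 1 (λ w → w :* con 0ℚ :+ con 0ℚ := con 0ℚ) refl (head w))

  dot-combination : ∀ {m n} (w : Vec n) (μ : Vec m) (v : Fin m → Vec n) →
    dot w (combination μ v) ≈ dot μ λ i → dot w (v i)
  dot-combination {zero}  w μ v = dot-zeroʳ w
  dot-combination {suc m} w μ v = begin-equality
    dot w (combination μ v)
      ≈⟨ dot-cong (λ _ → refl) (λ k → solve 2 (λ x y → x :+ y := y :+ x) refl
           (head μ * v zero k) (combination (tail μ) (v ∘ suc) k)) ⟩
    dot w (λ k → combination (tail μ) (v ∘ suc) k + head μ * v zero k)
      ≈⟨ dot-linear w (combination (tail μ) (v ∘ suc)) (v zero) (head μ) ⟩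
    dot w (combination (tail μ) (v ∘ suc)) + head μ * dot w (v zero)
      ≈⟨ +-cong (dot-combination w (tail μ) (v ∘ suc)) refl ⟩
    dot (tail μ) (λ i → dot w (v (suc i))) + head μ * dot w (v zero)
      ≈⟨ solve 2 (λ x y → x :+ y := y :+ x) refl
           (dot (tail μ) (λ i → dot w (v (suc i)))) (head μ * dot w (v zero)) ⟩
    dot μ (λ i → dot w (v i)) ∎

  dot-nonNeg : ∀ {n} (u : Vec n) → 0F ≤ dot u u
  dot-nonNeg {zero}  u = ≤-refl
  dot-nonNeg {suc n} u = +-nonNeg (square-nonNeg (head u)) (dot-nonNeg (tail u))

  -- The law of cosines.
  dot-⊖-self : ∀ {n} (u v : Vec n) →
    dot (u ⊖ v) (u ⊖ v) + (dot u v + dot u v) ≈ dot u u + dot v v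
  dot-⊖-self {zero}  u v =
    solve 0 (con 0ℚ :+ (con 0ℚ :+ con 0ℚ) := con 0ℚ :+ con 0ℚ) refl
  dot-⊖-self {suc n} u v = begin-equality
    dot (u ⊖ v) (u ⊖ v) + (dot u v + dot u v)
      ≈⟨ solve 4 (λ x y s t →
           ((x :- y) :* (x :- y) :+ s) :+ ((x :* y :+ t) :+ (x :* y :+ t))
             := (x :* x :+ y :* y) :+ (s :+ (t :+ t))) refl
           (head u) (head v) (dot (tail u ⊖ tail v) (tail u ⊖ tail v))
           (dot (tail u) (tail v)) ⟩
    (head u * head u + head v * head v)
      + (dot (tail u ⊖ tail v) (tail u ⊖ tail v)
         + (dot (tail u) (tail v) + dot (tail u) (tail v)))
      ≈⟨ +-cong refl (dot-⊖-self (tail u) (tail v)) ⟩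
    (head u * head u + head v * head v)
      + (dot (tail u) (tail u) + dot (tail v) (tail v))
      ≈⟨ solve 4 (λ a b c d → (a :+ b) :+ (c :+ d) := (a :+ c) :+ (b :+ d)) refl
           (head u * head u) (head v * head v)
           (dot (tail u) (tail u)) (dot (tail v) (tail v)) ⟩
    dot u u + dot v v ∎

  dot-⊖ʳ : ∀ {n} (w u v : Vec n) → dot w (u ⊖ v) ≈ dot w u - dot w v
  dot-⊖ʳ w u v = begin-equality
    dot w (u ⊖ v)
      ≈⟨ dot-cong (λ _ → refl) (λ k →
           solve 2 (λ x y → x :- y := x :+ con (ℚ.- 1ℚ) :* y) refl (u k) (v k)) ⟩
    dot w (λ k → u k + ι (ℚ.- 1ℚ) * v k)
      ≈⟨ dot-linear w u v (ι (ℚ.- 1ℚ)) ⟩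
    dot w u + ι (ℚ.- 1ℚ) * dot w v
      ≈⟨ solve 2 (λ x y → x :+ con (ℚ.- 1ℚ) :* y := x :- y) refl
           (dot w u) (dot w v) ⟩
    dot w u - dot w v ∎

  sqDist-translate : ∀ {n} (u v w : Vec n) → sqDist (u ⊖ w) (v ⊖ w) ≈ sqDist u v
  sqDist-translate u v w = dot-cong eq eq
    where
    eq : ((u ⊖ w) ⊖ (v ⊖ w)) ≈ᵛ (u ⊖ v)
    eq k = solve 3 (λ x y z → (x :- z) :- (y :- z) := x :- y) refl (u k) (v k) (w k)

  sqDist-cong : ∀ {n} {u u′ v v′ : Vec n} → u ≈ᵛ u′ → v ≈ᵛ v′ →
    sqDist u v ≈ sqDist u′ v′
  sqDist-cong u≈u′ v≈v′ = dot-cong eq eq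
    where eq = λ k → +-cong (u≈u′ k) (-‿cong (v≈v′ k))

  sqDist-sym : ∀ {n} (u v : Vec n) → sqDist u v ≈ sqDist v u
  sqDist-sym {zero}  u v = refl
  sqDist-sym {suc n} u v = +-cong
    (solve 2 (λ x y → (x :- y) :* (x :- y) := (y :- x) :* (y :- x)) refl (head u) (head v))
    (sqDist-sym (tail u) (tail v))

  -- Orthogonal projection onto a span

  square-null : ∀ {x} → x * x ≤ 0F → x ≈ 0F
  square-null {x} x²≤0 = antisym (square-cancel-≤ ≤-refl x²≤0²)
    (≤-by (0F - (0F - x)) (≤⇒0≤- (square-cancel-≤ ≤-refl (≤-trans
      (≤-reflexive (solve 1 (λ x → (con 0ℚ :- x) :* (con 0ℚ :- x) := x :* x) refl x)) x²≤0²)))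
      (solve 1 (λ x → x := con 0ℚ :+ (con 0ℚ :- (con 0ℚ :- x))) refl x))
    where
    x²≤0² = ≤-trans x²≤0 (≤-reflexive (solve 0 (con 0ℚ := con 0ℚ :* con 0ℚ) refl))

  -- Covers linearly dependent vectors: when the residual to divide by vanishes, the numerator of
  -- the Gram-Schmidt coefficient vanishes with it.
  dot-null : ∀ {n} (w u : Vec n) → dot u u ≤ 0F → dot w u ≈ 0F
  dot-null {zero}  w u _    = refl
  dot-null {suc n} w u u²≤0 = trans
    (+-cong (*-cong refl (square-null (≤-trans
        (≤-by (dot (tail u) (tail u)) (dot-nonNeg (tail u)) refl) u²≤0)))
      (dot-null (tail w) (tail u) (≤-trans
        (≤-by (head u * head u) (square-nonNeg (head u))
          (solve 2 (λ x y → x :+ y := y :+ x) refl _ _)) u²≤0)))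
    (solve 1 (λ w → w :* con 0ℚ :+ con 0ℚ := con 0ℚ) refl (head w))

  Orthogonal : ∀ {m n} → Vec n → (Fin m → Vec n) → Set
  Orthogonal w v = ∀ j → dot w (v j) ≈ 0F

  Projection : ∀ {m n} → (Fin m → Vec n) → Vec n → Set
  Projection v u = ∃[ μ ] Orthogonal (u ⊖ combination μ v) v

  dot-residual : ∀ {m n} (v : Fin m → Vec n) (u w : Vec n) (μ : Vec m) →
    Orthogonal w v → dot w (u ⊖ combination μ v) ≈ dot w u
  dot-residual v u w μ w⊥v = begin-equality
    dot w (u ⊖ combination μ v)
      ≈⟨ dot-⊖ʳ w u (combination μ v) ⟩
    dot w u - dot w (combination μ v)
      ≈⟨ +-cong refl (-‿cong (trans (dot-combination w μ v)
           (trans (dot-cong (λ _ → refl) w⊥v) (dot-zeroʳ μ)))) ⟩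
    dot w u - 0F
      ≈⟨ solve 1 (λ x → x :- con 0ℚ := x) refl (dot w u) ⟩
    dot w u ∎

  -- One Gram-Schmidt step. `w` is `v zero` made orthogonal to the other vectors, and the projection
  -- of `u` gains the multiple `c` of `w`. The value of `c` is fixed by an equation instead of a
  -- quotient, because `w` may be zero.
  module GramSchmidt {m n} (v : Fin (suc m) → Vec n) (u : Vec n) (ν μ : Vec m) (c : Carrier)
    where

    private
      w r : Vec n
      w = v zero ⊖ combination ν (v ∘ suc)
      r = u ⊖ combination μ (v ∘ suc)

    -- The vector `combination μ (v ∘ suc)` plus `c` times `w`, rewritten in terms of the original
    -- family `v`.
    coefficients : Vec (suc m)
    coefficients = c ∷ λ i → μ i + (- c) * ν i

    residual : ∀ x → dot (u ⊖ combination coefficients v) x ≈ dot r x - c * dot w x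
    residual x = begin-equality
      dot (u ⊖ combination coefficients v) x
        ≈⟨ dot-cong eq (λ _ → refl) ⟩
      dot (λ k → r k + (- c) * w k) x
        ≈⟨ dot-comm (λ k → r k + (- c) * w k) x ⟩
      dot x (λ k → r k + (- c) * w k)
        ≈⟨ dot-linear x r w (- c) ⟩
      dot x r + (- c) * dot x w
        ≈⟨ +-cong (dot-comm x r) (*-cong refl (dot-comm x w)) ⟩
      dot r x + (- c) * dot w x
        ≈⟨ solve 3 (λ a c b → a :+ (:- c) :* b := a :- c :* b) refl
             (dot r x) c (dot w x) ⟩
      dot r x - c * dot w x ∎
      where
      eq : (u ⊖ combination coefficients v) ≈ᵛ (λ k → r k + (- c) * w k)
      eq k = trans
        (+-cong refl (-‿cong (+-cong refl (trans (dot-comm _ column)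
          (trans (dot-linear column μ ν (- c))
            (+-cong (dot-comm column μ) (*-cong refl (dot-comm column ν))))))))
        (solve 5 (λ u c v₀ s t → u :- (c :* v₀ :+ (s :+ (:- c) :* t))
          := (u :- s) :+ (:- c) :* (v₀ :- t)) refl
          (u k) c (v zero k) (dot μ column) (dot ν column))
        where
        column : Vec m
        column i = v (suc i) k

    projection : Orthogonal w (v ∘ suc) → Orthogonal r (v ∘ suc) →
      c * dot w w ≈ dot r w → Projection v u
    projection w⊥ r⊥ c-eq = coefficients , λ
      { zero    → begin-equality
          dot (u ⊖ combination coefficients v) (v zero)
            ≈⟨ residual (v zero) ⟩
          dot r (v zero) - c * dot w (v zero)
            ≈⟨ +-cong (dot-residual (v ∘ suc) (v zero) r ν r⊥)
                 (-‿cong (*-cong refl (dot-residual (v ∘ suc) (v zero) w ν w⊥))) ⟨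
          dot r w - c * dot w w
            ≈⟨ +-cong refl (-‿cong c-eq) ⟩
          dot r w - dot r w
            ≈⟨ solve 1 (λ x → x :- x := con 0ℚ) refl (dot r w) ⟩
          0F ∎
      ; (suc j) → begin-equality
          dot (u ⊖ combination coefficients v) (v (suc j))
            ≈⟨ residual (v (suc j)) ⟩
          dot r (v (suc j)) - c * dot w (v (suc j))
            ≈⟨ +-cong (r⊥ j) (-‿cong (*-cong refl (w⊥ j))) ⟩
          0F - c * 0F
            ≈⟨ solve 1 (λ c → con 0ℚ :- c :* con 0ℚ := con 0ℚ) refl c ⟩
          0F ∎
      }

  -- Excluded middle on `x ≤ 0F` in disguise: that case calls `k` with quotient 0, and its
  -- refutation is what `inverse` needs for the other.
  divide : ∀ x y → (x ≤ 0F → y ≈ 0F) → ¬ ¬ (∃[ c ] c * x ≈ y)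
  divide x y null k = inverse
    (λ x≤0 → k (0F , trans (solve 1 (λ x → con 0ℚ :* x := con 0ℚ) refl x) (sym (null x≤0))))
    λ { (v , vx≈1) → k (y * v , trans
      (solve 3 (λ x y v → y :* v :* x := y :* (v :* x)) refl x y v)
      (trans (*-cong refl vx≈1) (solve 1 (λ y → y :* con 1ℚ := y) refl y))) }

  -- Both `u` and `v zero` are projected onto the remaining vectors, so no orthogonal basis is ever
  -- stored and dependent vectors need not be discarded.
  project : ∀ {m n} (v : Fin m → Vec n) (u : Vec n) → ¬ ¬ Projection v u
  project {zero}  v u k = k ((λ ()) , λ ())
  project {suc m} v u k =
    project (v ∘ suc) (v zero) λ { (ν , w⊥) →
    project (v ∘ suc) u        λ { (μ , r⊥) →
    divide _ _ (dot-null (u ⊖ combination μ (v ∘ suc)) (v zero ⊖ combination ν (v ∘ suc)))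
      λ { (c , c-eq) → k (GramSchmidt.projection v u ν μ c w⊥ r⊥ c-eq) }}}

  -- Affine combinations

  total : ∀ {m} → Vec m → Carrier
  total μ = dot μ λ _ → 1F

  dot-shift : ∀ {m} (μ x : Vec m) c → dot μ (λ i → x i - c) ≈ dot μ x - c * total μ
  dot-shift μ x c = begin-equality
    dot μ (λ i → x i - c)
      ≈⟨ dot-cong (λ _ → refl) (λ i →
           solve 2 (λ x c → x :- c := x :+ (:- c) :* con 1ℚ) refl (x i) c) ⟩
    dot μ (λ i → x i + (- c) * 1F)
      ≈⟨ dot-linear μ x (λ _ → 1F) (- c) ⟩
    dot μ x + (- c) * total μ
      ≈⟨ solve 3 (λ x c t → x :+ (:- c) :* t := x :- c :* t) refl (dot μ x) c (total μ) ⟩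
    dot μ x - c * total μ ∎

  record AffineCentre {m d} (a : Fin m → Vec d) (R : Carrier) : Set where
    field
      weights     : Vec m
      normalised  : total weights ≈ 1F
      equidistant : ∀ i → sqDist (a i) (combination weights a) ≈ R

  module _ {m d} (a : Fin (suc m) → Vec d) (c : Vec d) (P : Carrier)
           (on-sphere : ∀ i → sqDist (a i) c ≈ P) where

    private
      v : Fin m → Vec d
      v i = a (suc i) ⊖ a zero

      p : Fin (suc m) → Vec d
      p i = a i ⊖ a zero

      u : Vec d
      u = c ⊖ a zero

    -- Replacing the centre by its projection onto the affine hull keeps it
    -- equidistant from all points.
    affineCentre⁺ : ¬ ¬ (∃ (AffineCentre a))
    affineCentre⁺ k = project v u λ { (μ , ⊥v) → k (centre μ ⊥v) }
      where
      module _ (μ : Vec m) (⊥v : Orthogonal (u ⊖ combination μ v) v) where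
        w : Vec d
        w = combination μ v

        λs : Vec (suc m)
        -- The base point `a zero` takes up whatever weight is missing from 1.
        λs = (1F - total μ) ∷ μ

        offset : (combination λs a ⊖ a zero) ≈ᵛ w
        offset k = trans
          (solve 3 (λ t a s → ((con 1ℚ :- t) :* a :+ s) :- a := s :- a :* t)
            refl (total μ) (a zero k) (dot μ λ i → a (suc i) k))
          (sym (dot-shift μ (λ i → a (suc i) k) (a zero k)))

        -- The difference `u ⊖ w` is orthogonal to every `p i`. By the law of cosines, replacing `u`
        -- by `w` therefore changes all squared distances from the `p i` by the same constant.
        same-dot : ∀ i → dot (p i) u ≈ dot (p i) w
        same-dot zero    = trans (null u) (sym (null w))
          where
          null : ∀ x → dot (p zero) x ≈ 0F
          null x = trans (dot-comm (p zero) x) (trans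
            (dot-cong (λ _ → refl) λ k → solve 1 (λ x → x :- x := con 0ℚ) refl (a zero k))
            (dot-zeroʳ x))
        same-dot (suc i) = trans
          (solve 2 (λ x y → x := (x :- y) :+ y) refl _ _)
          (trans (+-cong (trans (sym (dot-⊖ʳ (v i) u w))
                   (trans (dot-comm (v i) (u ⊖ w)) (⊥v i))) refl)
            (solve 1 (λ x → con 0ℚ :+ x := x) refl _))

        centre : ∃ (AffineCentre a)
        -- By Pythagoras this is `P` minus the squared distance of `c` from the affine hull.
        centre = (P - dot u u) + dot w w , record
          { weights     = λs
          ; normalised  = solve 1 (λ t → (con 1ℚ :- t) :* con 1ℚ :+ t := con 1ℚ)
              refl (total μ)
          ; equidistant = λ i → begin-equality
              sqDist (a i) (combination λs a)
                ≈⟨ sqDist-translate (a i) (combination λs a) (a zero) ⟨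
              sqDist (p i) (combination λs a ⊖ a zero)
                ≈⟨ sqDist-cong (λ _ → refl) offset ⟩
              sqDist (p i) w
                ≈⟨ solve 2 (λ s t → s := (s :+ (t :+ t)) :- (t :+ t)) refl
                     (sqDist (p i) w) (dot (p i) w) ⟩
              (sqDist (p i) w + (dot (p i) w + dot (p i) w))
                - (dot (p i) w + dot (p i) w)
                ≈⟨ +-cong (dot-⊖-self (p i) w)
                     (-‿cong (+-cong (sym (same-dot i)) (sym (same-dot i)))) ⟩
              (dot (p i) (p i) + dot w w) - (dot (p i) u + dot (p i) u)
                ≈⟨ solve 4 (λ pp ww t uu → (pp :+ ww) :- (t :+ t)
                     := (((pp :+ uu) :- (t :+ t)) :- uu) :+ ww) refl
                     (dot (p i) (p i)) (dot w w) (dot (p i) u) (dot u u) ⟩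
              ((dot (p i) (p i) + dot u u) - (dot (p i) u + dot (p i) u))
                - dot u u + dot w w
                ≈⟨ +-cong (+-cong (+-cong (sym (dot-⊖-self (p i) u)) refl) refl) refl ⟩
              ((sqDist (p i) u + (dot (p i) u + dot (p i) u))
                - (dot (p i) u + dot (p i) u)) - dot u u + dot w w
                ≈⟨ +-cong (+-cong (solve 2 (λ s t → (s :+ (t :+ t)) :- (t :+ t) := s)
                     refl (sqDist (p i) u) (dot (p i) u)) refl) refl ⟩
              sqDist (p i) u - dot u u + dot w w
                ≈⟨ +-cong (+-cong (trans (sqDist-translate (a i) c (a zero))
                     (on-sphere i)) refl) refl ⟩
              P - dot u u + dot w w ∎
          }

  affineCentre : ∀ {m d} (a : Fin m → Vec d) → Fin m → ∀ c P →
    (∀ i → sqDist (a i) c ≈ P) → ¬ ¬ (∃ (AffineCentre a))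
  affineCentre {suc m} a _ = affineCentre⁺ a

  -- Second moments under affine weights

  module _ {m} (μ : Vec m) (normalised : total μ ≈ 1F) where

    private
      -2F : Carrier
      -2F = - (1F + 1F)

      mean : ∀ p c s →
        dot μ (λ i → (p i + -2F * c i) + s * 1F) ≈ (dot μ p + -2F * dot μ c) + s
      mean p c s = begin-equality
        dot μ (λ i → (p i + -2F * c i) + s * 1F)
          ≈⟨ dot-linear μ (λ i → p i + -2F * c i) (λ _ → 1F) s ⟩
        dot μ (λ i → p i + -2F * c i) + s * total μ
          ≈⟨ +-cong (dot-linear μ p c -2F) (*-cong refl normalised) ⟩
        (dot μ p + -2F * dot μ c) + s * 1F
          ≈⟨ solve 2 (λ x s → x :+ s :* con 1ℚ := x :+ s) refl _ s ⟩
        (dot μ p + -2F * dot μ c) + s ∎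

    pairwise : ∀ {n} → (Fin m → Vec n) → Carrier
    pairwise x = dot μ λ i → dot μ λ j → sqDist (x i) (x j)

    moment : ∀ {n} → (Fin m → Vec n) → Vec n → Carrier
    moment x z = dot μ λ i → sqDist (x i) z

    -- The parallel axis identity, doubled to avoid fractions. Since the weights sum to 1, `M` is
    -- the barycentre of the points minus `z`.
    pairwise-moment : ∀ {n} (x : Fin m → Vec n) (z : Vec n) →
      let M = combination μ (λ i → x i ⊖ z) in
      pairwise x + (dot M M + dot M M) ≈ moment x z + moment x z
    pairwise-moment {n} x z = begin-equality
      pairwise x + (dot M M + dot M M)
        ≈⟨ +-cong (dot-cong (λ _ → refl) inner) refl ⟩
      dot μ (λ i → (sqDist (x i) z + -2F * dot (u i) M) + E * 1F) + (dot M M + dot M M)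
        ≈⟨ +-cong (mean _ (λ i → dot (u i) M) E) refl ⟩
      (E + -2F * dot μ (λ i → dot (u i) M)) + E + (dot M M + dot M M)
        ≈⟨ +-cong (+-cong (+-cong refl (*-cong refl outer)) refl) refl ⟩
      (E + -2F * dot M M) + E + (dot M M + dot M M)
        ≈⟨ solve 2 (λ e m → (e :+ (:- (con 1ℚ :+ con 1ℚ)) :* m) :+ e :+ (m :+ m)
             := e :+ e) refl E (dot M M) ⟩
      E + E ∎
      where
      u : Fin m → Vec n
      u i = x i ⊖ z
      M : Vec n
      M = combination μ u
      E = moment x z

      outer : dot μ (λ i → dot (u i) M) ≈ dot M M
      outer = trans (dot-cong (λ _ → refl) λ i → dot-comm (u i) M)
        (sym (dot-combination M μ u))

      expand : ∀ i j → sqDist (x i) (x j)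
        ≈ (sqDist (x j) z + -2F * dot (u i) (u j)) + sqDist (x i) z * 1F
      expand i j = begin-equality
        sqDist (x i) (x j)
          ≈⟨ sqDist-translate (x i) (x j) z ⟨
        sqDist (u i) (u j)
          ≈⟨ solve 2 (λ s t → s := (s :+ (t :+ t)) :- (t :+ t)) refl
               (sqDist (u i) (u j)) (dot (u i) (u j)) ⟩
        (sqDist (u i) (u j) + (dot (u i) (u j) + dot (u i) (u j)))
          - (dot (u i) (u j) + dot (u i) (u j))
          ≈⟨ +-cong (dot-⊖-self (u i) (u j)) refl ⟩
        (sqDist (x i) z + sqDist (x j) z) - (dot (u i) (u j) + dot (u i) (u j))
          ≈⟨ solve 3 (λ a b t → (a :+ b) :- (t :+ t)
               := (b :+ (:- (con 1ℚ :+ con 1ℚ)) :* t) :+ a :* con 1ℚ) refl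
               (sqDist (x i) z) (sqDist (x j) z) (dot (u i) (u j)) ⟩
        (sqDist (x j) z + -2F * dot (u i) (u j)) + sqDist (x i) z * 1F ∎

      inner : ∀ i → dot μ (λ j → sqDist (x i) (x j))
        ≈ (sqDist (x i) z + -2F * dot (u i) M) + E * 1F
      inner i = begin-equality
        dot μ (λ j → sqDist (x i) (x j))
          ≈⟨ dot-cong (λ _ → refl) (expand i) ⟩
        dot μ (λ j → (sqDist (x j) z + -2F * dot (u i) (u j)) + sqDist (x i) z * 1F)
          ≈⟨ mean _ (λ j → dot (u i) (u j)) (sqDist (x i) z) ⟩
        (E + -2F * dot μ (λ j → dot (u i) (u j))) + sqDist (x i) z
          ≈⟨ +-cong (+-cong refl (*-cong refl (dot-combination (u i) μ u))) refl ⟨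
        (E + -2F * dot (u i) M) + sqDist (x i) z
          ≈⟨ solve 3 (λ e t s → (e :+ t) :+ s := (s :+ t) :+ e :* con 1ℚ) refl
               E (-2F * dot (u i) M) (sqDist (x i) z) ⟩
        (sqDist (x i) z + -2F * dot (u i) M) + E * 1F ∎

  -- Both moments exceed the same pairwise sum by a square, which vanishes at the
  -- affine centre of a.
  moment-bound : ∀ {m d n R} {a : Fin m → Vec d} (A : AffineCentre a R) →
    let open AffineCentre A in
    (x : Fin m → Vec n) → (∀ i j → sqDist (x i) (x j) ≈ sqDist (a i) (a j)) →
    ∀ z → R + R ≤ moment weights normalised x z + moment weights normalised x z
  moment-bound {R = R} {a} A x isometric z = begin
    R + R
      ≈⟨ +-cong E≈R E≈R ⟨
    moment weights normalised a c + moment weights normalised a c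
      ≈⟨ pairwise-moment weights normalised a c ⟨
    pairwise weights normalised a + (dot M M + dot M M)
      ≈⟨ +-cong (dot-cong (λ _ → refl) λ i → dot-cong (λ _ → refl) λ j →
           sym (isometric i j)) (+-cong MM≈0 MM≈0) ⟩
    pairwise weights normalised x + (0F + 0F)
      ≤⟨ +-mono-≤ ≤-refl (+-mono-≤ (dot-nonNeg N) (dot-nonNeg N)) ⟩
    pairwise weights normalised x + (dot N N + dot N N)
      ≈⟨ pairwise-moment weights normalised x z ⟩
    moment weights normalised x z + moment weights normalised x z ∎
    where
    open AffineCentre A
    c = combination weights a
    M = combination weights λ i → a i ⊖ c
    N = combination weights λ i → x i ⊖ z

    E≈R : moment weights normalised a c ≈ R
    E≈R = trans
      (dot-cong (λ _ → refl) λ i → trans (equidistant i)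
        (solve 1 (λ r → r := con 0ℚ :+ r :* con 1ℚ) refl R))
      (trans (dot-linear weights (λ _ → 0F) (λ _ → 1F) R)
        (trans (+-cong (dot-zeroʳ weights) (*-cong refl normalised))
          (solve 1 (λ r → con 0ℚ :+ r :* con 1ℚ := r) refl R)))

    MM≈0 : dot M M ≈ 0F
    MM≈0 = trans (dot-cong (λ _ → refl) λ k →
        trans (dot-shift weights (λ i → a i k) (c k))
          (trans (+-cong refl (-‿cong (*-cong refl normalised)))
            (solve 1 (λ c → c :- c :* con 1ℚ := con 0ℚ) refl (c k))))
      (dot-zeroʳ M)

  -- Jung's bound for the radius of an enclosing ball

  -- Stewart's theorem for the point at parameter `t` on the segment from `z` to `b`.
  mixture : ∀ {n} (t : Carrier) (z b y : Vec n) →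
    sqDist (λ k → z k + t * (b k - z k)) y + t * (1F - t) * sqDist b z
      ≈ (1F - t) * sqDist z y + t * sqDist b y
  mixture {zero}  t z b y = solve 1 (λ t → con 0ℚ :+ t :* (con 1ℚ :- t) :* con 0ℚ
    := (con 1ℚ :- t) :* con 0ℚ :+ t :* con 0ℚ) refl t
  mixture {suc n} t z b y = begin-equality
    sqDist (λ k → z k + t * (b k - z k)) y + t * (1F - t) * sqDist b z
      ≈⟨ solve 6 (λ t z b y s r →
           ((z :+ t :* (b :- z)) :- y) :* ((z :+ t :* (b :- z)) :- y) :+ s
             :+ t :* (con 1ℚ :- t) :* ((b :- z) :* (b :- z) :+ r)
           := ((con 1ℚ :- t) :* ((z :- y) :* (z :- y)) :+ t :* ((b :- y) :* (b :- y)))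
             :+ (s :+ t :* (con 1ℚ :- t) :* r)) refl
           t (head z) (head b) (head y)
           (sqDist (λ k → tail z k + t * (tail b k - tail z k)) (tail y))
           (sqDist (tail b) (tail z)) ⟩
    ((1F - t) * ((head z - head y) * (head z - head y))
      + t * ((head b - head y) * (head b - head y)))
      + (sqDist (λ k → tail z k + t * (tail b k - tail z k)) (tail y)
         + t * (1F - t) * sqDist (tail b) (tail z))
      ≈⟨ +-cong refl (mixture t (tail z) (tail b) (tail y)) ⟩
    ((1F - t) * ((head z - head y) * (head z - head y))
      + t * ((head b - head y) * (head b - head y)))
      + ((1F - t) * sqDist (tail z) (tail y) + t * sqDist (tail b) (tail y))
      ≈⟨ solve 5 (λ t p q r s →
           ((con 1ℚ :- t) :* p :+ t :* q) :+ ((con 1ℚ :- t) :* r :+ t :* s)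
           := (con 1ℚ :- t) :* (p :+ r) :+ t :* (q :+ s)) refl t
           ((head z - head y) * (head z - head y)) ((head b - head y) * (head b - head y))
           (sqDist (tail z) (tail y)) (sqDist (tail b) (tail y)) ⟩
    (1F - t) * sqDist z y + t * sqDist b y ∎

  module Enclosing {k n} (b : Fin k → Vec n) (i₀ : Fin k) (D : Carrier)
                   (diameter : ∀ i j → sqDist (b i) (b j) ≤ D) where

    -- Holds when z is a convex combination of the points and f its variance.
    Barycentric : Vec n → Carrier → Set
    Barycentric z f = ∀ y M → (∀ i → sqDist (b i) y ≤ M) → f + sqDist z y ≤ M

    -- The origin of the factor 1/√2. Averaging the distances to a fixed `b i` puts that point
    -- within squared distance `D - f` of `z`; averaging these bounds over the points gives
    -- `f ≤ D - f`.
    variance-bound : ∀ {z f} → Barycentric z f → f + f ≤ D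
    variance-bound {z} {f} bary = begin
      f + f
        ≤⟨ +-mono-≤ (≤-by (sqDist z z) (dot-nonNeg (z ⊖ z)) refl) ≤-refl ⟩
      f + sqDist z z + f
        ≤⟨ +-mono-≤ (bary z (D - f) λ i → ≤-by (D - (f + sqDist z (b i)))
             (≤⇒0≤- (bary (b i) D λ j → diameter j i))
             (trans (solve 3 (λ d f s → d :- f := s :+ (d :- (f :+ s))) refl
               D f (sqDist z (b i))) (+-cong (sqDist-sym z (b i)) refl))) ≤-refl ⟩
      D - f + f
        ≈⟨ solve 2 (λ d f → d :- f :+ f := d) refl D f ⟩
      D ∎

    initial : Barycentric (b i₀) 0F
    initial y M h = ≤-trans
      (≤-reflexive (solve 1 (λ s → con 0ℚ :+ s := s) refl (sqDist (b i₀) y))) (h i₀)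

    -- Here `r` is twice a squared radius, so that Jung's radius δ/√2 corresponds to `r = D`.
    Encloses : Carrier → Vec n → Set
    Encloses r z = ∀ i → sqDist (b i) z + sqDist (b i) z ≤ r

    module _ (η : Carrier) (η>0 : ¬ η ≤ 0F) (small-step : Small (D + η) η) where

      open Small small-step
      private
        g = t * η

      quadruple : Carrier → Carrier
      quadruple f = (f + f) + (f + f)

      -- Moving `z` by the fraction `t` towards the far point changes the variance by t(1 - t)q -
      -- tf. As 2q ≥ D + η and 2f ≤ D, four times this change is at least 2tη - 2t²(D + η), and 2t(D
      -- + η) ≤ η leaves tη, which is `g`.
      improve : ∀ {z f} → Barycentric z f → ∀ i → D + η ≤ sqDist (b i) z + sqDist (b i) z →
        ∃[ z′ ] ∃[ f′ ] Barycentric z′ f′ × quadruple f + g ≤ quadruple f′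
      improve {z} {f} bary i far = z′ , f′ , bary′ , gain
        where
        q = sqDist (b i) z
        z′ : Vec n
        z′ k = z k + t * (b i k - z k)
        -- Variance of the mixture of the old distribution, with weight `1F - t`, and a point mass
        -- at `b i`.
        f′ = (1F - t) * f + t * (1F - t) * q

        bary′ : Barycentric z′ f′
        bary′ y M h = begin
          f′ + sqDist z′ y
            ≈⟨ solve 3 (λ x a s → (x :+ a) :+ s := x :+ (s :+ a)) refl
                 ((1F - t) * f) (t * (1F - t) * q) (sqDist z′ y) ⟩
          (1F - t) * f + (sqDist z′ y + t * (1F - t) * q)
            ≈⟨ +-cong refl (mixture t z (b i) y) ⟩
          (1F - t) * f + ((1F - t) * sqDist z y + t * sqDist (b i) y)
            ≤⟨ ≤-by ((1F - t) * (M - (f + sqDist z y)) + t * (M - sqDist (b i) y))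
                 (+-nonNeg (*-nonNeg (≤⇒0≤- t≤1) (≤⇒0≤- (bary y M h)))
                           (*-nonNeg t≥0 (≤⇒0≤- (h i))))
                 (solve 5 (λ t f m s q → m :=
                   (con 1ℚ :- t) :* f :+ ((con 1ℚ :- t) :* s :+ t :* q)
                   :+ ((con 1ℚ :- t) :* (m :- (f :+ s)) :+ t :* (m :- q))) refl
                   t f M (sqDist z y) (sqDist (b i) y)) ⟩
          M ∎

        s₁ = t * (1F - t) * ((q + q) - (D + η))
        s₂ = t * (D - (f + f))

        gain : quadruple f + g ≤ quadruple f′
        gain = ≤-by ((s₁ + s₁) + (s₂ + s₂) + t * (η - (t * (D + η) + t * (D + η))))
          (+-nonNeg (+-nonNeg (+-nonNeg 0≤s₁ 0≤s₁) (+-nonNeg 0≤s₂ 0≤s₂))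
            (*-nonNeg t≥0 (≤⇒0≤- 2tx≤e)))
          (solve 5 (λ t f q d e →
            let f′ = (con 1ℚ :- t) :* f :+ t :* (con 1ℚ :- t) :* q
                s₁ = t :* (con 1ℚ :- t) :* ((q :+ q) :- (d :+ e))
                s₂ = t :* (d :- (f :+ f))
            in (f′ :+ f′) :+ (f′ :+ f′) := ((f :+ f) :+ (f :+ f)) :+ t :* e
              :+ ((s₁ :+ s₁) :+ (s₂ :+ s₂)
                  :+ t :* (e :- (t :* (d :+ e) :+ t :* (d :+ e))))) refl t f q D η)
          where
          0≤s₁ = *-nonNeg (*-nonNeg t≥0 (≤⇒0≤- t≤1)) (≤⇒0≤- far)
          0≤s₂ = *-nonNeg t≥0 (≤⇒0≤- (variance-bound bary))

      -- Each far point raises the variance by a fixed amount, and the variance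
      -- is bounded, so the process stops.
      descend : ∀ N {z f} → Barycentric z f → D + D ≤ quadruple f + ι (fromℕ N) * g →
        ¬ (∃ (Encloses (D + η))) → ⊥
      descend N {z} {f} bary bound none =
        -- No search for a far point takes place. Each enclosing inequality is stable, so it may be
        -- proved by refuting its negation, and that negation makes `b i` a far point.
        none (z , λ i → ≤-stable λ far → continue N bound (improve bary i (≰⇒≥ far)))
        where
        continue : ∀ N → D + D ≤ quadruple f + ι (fromℕ N) * g →
          ∃[ z′ ] ∃[ f′ ] Barycentric z′ f′ × quadruple f + g ≤ quadruple f′ → ⊥
        -- With no steps left, `quadruple f` has already reached its upper bound `D + D`; one more
        -- gain would force `g ≤ 0F`.
        continue zero    bound (z′ , f′ , bary′ , gain) = *-pos t>0 η>0
          (≤-by ((quadruple f + 0F * g - (D + D)) + (quadruple f′ - (quadruple f + g))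
                  + ((D - (f′ + f′)) + (D - (f′ + f′))))
            (+-nonNeg (+-nonNeg (≤⇒0≤- bound) (≤⇒0≤- gain))
              (let h = ≤⇒0≤- (variance-bound bary′) in +-nonNeg h h))
            (solve 4 (λ d f f′ g → con 0ℚ := g :+
              (((f :+ f) :+ (f :+ f) :+ con 0ℚ :* g :- (d :+ d))
               :+ ((f′ :+ f′) :+ (f′ :+ f′) :- ((f :+ f) :+ (f :+ f) :+ g))
               :+ ((d :- (f′ :+ f′)) :+ (d :- (f′ :+ f′))))) refl D f f′ g))
        continue (suc N) bound (z′ , f′ , bary′ , gain) = descend N bary′ (begin
          D + D
            ≤⟨ bound ⟩
          quadruple f + ι (fromℕ (suc N)) * g
            ≈⟨ +-cong refl (*-cong (ι-+ 1ℚ (fromℕ N)) refl) ⟩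
          quadruple f + (1F + ι (fromℕ N)) * g
            ≈⟨ solve 3 (λ f n g → f :+ (con 1ℚ :+ n) :* g := (f :+ g) :+ n :* g) refl
                 (quadruple f) (ι (fromℕ N)) g ⟩
          quadruple f + g + ι (fromℕ N) * g
            ≤⟨ +-mono-≤ gain ≤-refl ⟩
          quadruple f′ + ι (fromℕ N) * g ∎) none

    -- Starting from variance 0 at a single point, finitely many gains of size `t * η` use up the
    -- available `D + D`. A positive `η` keeps each gain positive.
    enclosing-ball : ∀ η → ¬ η ≤ 0F → ¬ ¬ (∃ (Encloses (D + η)))
    enclosing-ball η η>0 none = small (D + η) η>0 λ s →
      let open Small s in
      archimedean-* (D + D) (*-pos t>0 η>0) λ { (N , bound) →
      descend η η>0 s N initial (≤-trans bound (≤-by 0F ≤-refl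
        (solve 1 (λ x → ((con 0ℚ :+ con 0ℚ) :+ (con 0ℚ :+ con 0ℚ)) :+ x
          := x :+ con 0ℚ) refl _))) none }

  -- Colouring by distance shells

  level : ∀ {r} → Carrier → Carrier → Fin r → Carrier
  level s ε j = s + ι (fromℕ (toℕ j)) * ε

  -- Shells are closed at both ends and neighbours overlap, so membership consists of two weak
  -- inequalities; a colouring picks one admissible shell for each point.
  Shell : Carrier → Carrier → Carrier → ∀ {r} → Fin r → Set
  Shell s ε q j = level s ε j ≤ q × q ≤ level s ε j + ε

  shell : ∀ r s {q} ε → s ≤ q → q ≤ s + ι (fromℕ (suc r)) * ε →
    ¬ ¬ (∃ (Shell s ε q {suc r}))
  shell zero s {q} ε s≤q q≤ k = k (zero
    , ≤-trans (≤-reflexive (solve 2 (λ s ε → s :+ con 0ℚ :* ε := s) refl s ε)) s≤q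
    , ≤-trans q≤ (≤-reflexive (solve 2
        (λ s ε → s :+ con (1ℚ ℚ.+ 0ℚ) :* ε := s :+ con 0ℚ :* ε :+ ε) refl s ε)))
  shell (suc r) s {q} ε s≤q q≤ k = ¬¬-excluded-middle λ
    { (yes q≤s+ε) → k (zero
        , ≤-trans (≤-reflexive (solve 2 (λ s ε → s :+ con 0ℚ :* ε := s) refl s ε)) s≤q
        , ≤-trans q≤s+ε (≤-reflexive (solve 2
            (λ s ε → s :+ ε := s :+ con 0ℚ :* ε :+ ε) refl s ε)))
    ; (no q≰s+ε) → shell r (s + ε) ε (≰⇒≥ q≰s+ε)
        (≤-trans q≤ (≤-reflexive (shift (fromℕ (suc r)))))
        λ { (j , ≤q , q≤) → k (suc j
          , ≤-trans (≤-reflexive (shift (fromℕ (toℕ j)))) ≤q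
          , ≤-trans q≤ (≤-reflexive (sym (+-cong (shift (fromℕ (toℕ j))) refl)))) }
    }
    where
    shift : ∀ n → s + ι (1ℚ ℚ.+ n) * ε ≈ s + ε + ι n * ε
    shift n = trans (+-cong refl (*-cong (ι-+ 1ℚ n) refl))
      (solve 3 (λ s n ε → s :+ (con 1ℚ :+ n) :* ε := s :+ ε :+ n :* ε) refl s (ι n) ε)

  -- A polynomial upper bound for twice the sum of the absolute values of the weights.
  spread : ∀ {m} → Vec m → Carrier
  spread μ = sum λ i → 1F + μ i * μ i

  spread-nonNeg : ∀ {m} (μ : Vec m) → 0F ≤ spread μ
  spread-nonNeg {zero}  μ = ≤-refl
  spread-nonNeg {suc m} μ =
    +-nonNeg (+-nonNeg 0≤1 (square-nonNeg (head μ))) (spread-nonNeg (tail μ))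

  -- Uses 2x ≤ 1 + x² for each weight x, which may be negative.
  dot-spread : ∀ {m} (μ Q : Vec m) s ε → (∀ i → s ≤ Q i) → (∀ i → Q i ≤ s + ε) →
    dot μ Q + dot μ Q ≤ (s + s) * total μ + ε * spread μ
  dot-spread {zero}  μ Q s ε s≤Q Q≤ = ≤-reflexive (solve 2 (λ s ε →
    con 0ℚ :+ con 0ℚ := (s :+ s) :* con 0ℚ :+ ε :* con 0ℚ) refl s ε)
  dot-spread {suc m} μ Q s ε s≤Q Q≤ = ≤-by
    -- With x the weight and y = Q - s, the slack ε(1 + x²) - 2xy is split as (ε - y)(1 + x²) + y(1
    -- - x)², whose factors are all nonnegative.
    (((s + ε - head Q) * (1F + head μ * head μ)
      + (head Q - s) * ((1F - head μ) * (1F - head μ)))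
      + ((s + s) * total (tail μ) + ε * spread (tail μ)
         - (dot (tail μ) (tail Q) + dot (tail μ) (tail Q))))
    (+-nonNeg (+-nonNeg
        (*-nonNeg (≤⇒0≤- (Q≤ zero)) (+-nonNeg 0≤1 (square-nonNeg (head μ))))
        (*-nonNeg (≤⇒0≤- (s≤Q zero)) (square-nonNeg (1F - head μ))))
      (≤⇒0≤- (dot-spread (tail μ) (tail Q) s ε (s≤Q ∘ suc) (Q≤ ∘ suc))))
    (solve 7 (λ x q s ε t w d →
      (s :+ s) :* (x :* con 1ℚ :+ t) :+ ε :* ((con 1ℚ :+ x :* x) :+ w) :=
      (x :* q :+ d) :+ (x :* q :+ d) :+
      (((s :+ ε :- q) :* (con 1ℚ :+ x :* x)
        :+ (q :- s) :* ((con 1ℚ :- x) :* (con 1ℚ :- x)))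
        :+ ((s :+ s) :* t :+ ε :* w :- (d :+ d)))) refl
      (head μ) (head Q) s ε (total (tail μ)) (spread (tail μ)) (dot (tail μ) (tail Q)))

  module _ {m d} {a : Fin m → Vec d} (i₀ : Fin m) {R} (A : AffineCentre a R) (D : Carrier)
    where

    open AffineCentre A

    Isometric : ∀ {n} → (Fin m → Vec n) → Set
    Isometric x = ∀ i j → sqDist (x i) (x j) ≈ sqDist (a i) (a j)

    -- One `η` is the slack of the enclosing ball, the other the error due to the thickness of the
    -- shell. The point `x i₀` carries the bound of the ball over to the inner level `s`.
    thin-shell : ∀ {n} (x : Fin m → Vec n) → Isometric x → ∀ z η ε s →
      ε * spread weights ≤ η → (∀ i → sqDist (x i) z + sqDist (x i) z ≤ D + η) →
      (∀ i → s ≤ sqDist (x i) z) → (∀ i → sqDist (x i) z ≤ s + ε) →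
      R + R ≤ D + (η + η)
    thin-shell x isometric z η ε s εw≤η ball s≤ ≤s+ε = begin
      R + R
        ≤⟨ moment-bound A x isometric z ⟩
      moment weights normalised x z + moment weights normalised x z
        ≤⟨ dot-spread weights (λ i → sqDist (x i) z) s ε s≤ ≤s+ε ⟩
      (s + s) * total weights + ε * spread weights
        ≤⟨ +-mono-≤ (≤-reflexive (trans (*-cong refl normalised)
             (solve 1 (λ s → (s :+ s) :* con 1ℚ := s :+ s) refl s))) εw≤η ⟩
      s + s + η
        ≤⟨ +-mono-≤ (≤-trans (+-mono-≤ (s≤ i₀) (s≤ i₀)) (ball i₀)) ≤-refl ⟩
      D + η + η
        ≈⟨ solve 2 (λ d e → d :+ e :+ e := d :+ (e :+ e)) refl D η ⟩
      D + (η + η) ∎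

    Avoids : ∀ {k n r} → (Fin k → Vec n) → (Fin k → Fin r) → Set
    Avoids {k} b χ = ∀ (g : Fin m → Fin k) → Isometric (b ∘ g) →
      ¬ (∀ i j → χ (g i) ≡ χ (g j))

    -- `r` is found before `b` and its dimension are given, matching the order of quantifiers in
    -- `DiameterRamsey`. The inner double negation pays for the centre and the shells, which depend
    -- on `b`.
    avoiding-colouring : ¬ R + R ≤ D → ¬ ¬ (∃[ r ] ∀ {k n} (b : Fin k → Vec n) → Fin k →
      (∀ i j → sqDist (b i) (b j) ≤ D) → ¬ ¬ (∃ (Avoids {r = suc r} b)))
    avoiding-colouring D<2R k =
      -- Yields 4η ≤ 2R - D, which is incompatible with the conclusion 2R ≤ D + 2η of `thin-shell`.
      small (1F + 1F) (>⇒0<- D<2R)     λ S₁ →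
      small (spread weights) (Small.t>0 S₁) λ S₂ →
      -- `N` shells already cover all values up to `D + η`; using `suc N` of them keeps the number
      -- of colours nonzero.
      archimedean-* (D + Small.t S₁) (Small.t>0 S₂) λ { (N , bound) → k (N , colour S₁ S₂ N bound) }
      where
      module _ (S₁ : Small (1F + 1F) (R + R - D)) (S₂ : Small (spread weights) (Small.t S₁))
               (N : ℕ) (bound : D + Small.t S₁ ≤ ι (fromℕ N) * Small.t S₂) where

        η ε : Carrier
        η = Small.t S₁
        ε = Small.t S₂

        εw≤η : ε * spread weights ≤ η
        εw≤η = ≤-trans (≤-by (ε * spread weights)
          (*-nonNeg (Small.t≥0 S₂) (spread-nonNeg weights)) refl) (Small.2tx≤e S₂)

        too-large : ¬ R + R ≤ D + (η + η)
        too-large h = Small.t>0 S₁ (≤-by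
          ((D + (η + η) - (R + R)) + ((R + R - D) - (η * (1F + 1F) + η * (1F + 1F))) + η)
          (+-nonNeg (+-nonNeg (≤⇒0≤- h) (≤⇒0≤- (Small.2tx≤e S₁))) (Small.t≥0 S₁))
          (solve 3 (λ r d e → con 0ℚ := e :+ ((d :+ (e :+ e) :- (r :+ r))
            :+ ((r :+ r :- d) :- (e :* (con 1ℚ :+ con 1ℚ) :+ e :* (con 1ℚ :+ con 1ℚ)))
            :+ e)) refl R D η))

        colour : ∀ {k n} (b : Fin k → Vec n) → Fin k → (∀ i j → sqDist (b i) (b j) ≤ D) →
          ¬ ¬ (∃ (Avoids {r = suc N} b))
        colour {k} b j₀ diameter none =
          Enclosing.enclosing-ball b j₀ D diameter η (Small.t>0 S₁) λ { (z , ball) →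
          let q : Fin k → Carrier
              q i = sqDist (b i) z

              0≤q : ∀ i → 0F ≤ q i
              0≤q i = dot-nonNeg (b i ⊖ z)

              q≤ : ∀ i → q i ≤ 0F + ι (fromℕ (suc N)) * ε
              q≤ i = begin
                q i
                  ≤⟨ ≤-by (q i) (0≤q i) refl ⟩
                q i + q i
                  ≤⟨ ball i ⟩
                D + η
                  ≤⟨ bound ⟩
                ι (fromℕ N) * ε
                  ≤⟨ ≤-by ε (Small.t≥0 S₂) (trans
                       (+-cong refl (*-cong (ι-+ 1ℚ (fromℕ N)) refl))
                       (solve 2 (λ n e → con 0ℚ :+ (con 1ℚ :+ n) :* e := n :* e :+ e)
                         refl (ι (fromℕ N)) ε)) ⟩
                0F + ι (fromℕ (suc N)) * ε ∎
          in
          -- Finiteness of the family turns a doubly negated shell for each point into one doubly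
          -- negated colouring.
          sequence (RawMonad.rawApplicative ¬¬-Monad) (λ i → shell N 0F ε (0≤q i) (q≤ i))
            λ shells → none ((λ i → proj₁ (shells i)) , λ g isometric mono →
              too-large (thin-shell (b ∘ g) isometric z η ε
                (level 0F ε (proj₁ (shells (g i₀)))) εw≤η (λ i → ball (g i))
                (λ i → subst (λ j → level 0F ε j ≤ q (g i)) (mono i i₀)
                  (proj₁ (proj₂ (shells (g i)))))
                (λ i → subst (λ j → q (g i) ≤ level 0F ε j + ε) (mono i i₀)
                  (proj₂ (proj₂ (shells (g i))))))) }

open import Defs
open import Relation.Binary.PropositionalEquality using (refl; sym; trans; cong₂; subst₂)

-- Rational estimates

private
  module ℚ-Estimates where
    open +-*-Solver
    open ℚₚ.≤-Reasoning

    ∣∣-lub : ∀ {p ε} → p ℚ.≤ ε → ℚ.- p ℚ.≤ ε → ∣ p ∣ ℚ.≤ ε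
    ∣∣-lub {p} p≤ε -p≤ε with ℚₚ.∣p∣≡p∨∣p∣≡-p p
    ... | inj₁ eq = subst (ℚ._≤ _) (sym eq) p≤ε
    ... | inj₂ eq = subst (ℚ._≤ _) (sym eq) -p≤ε

    p≤∣p∣ : ∀ p → p ℚ.≤ ∣ p ∣
    p≤∣p∣ p with ℚₚ.≤-total 0ℚ p
    ... | inj₁ 0≤p = ℚₚ.≤-reflexive (sym (ℚₚ.0≤p⇒∣p∣≡p 0≤p))
    ... | inj₂ p≤0 = ℚₚ.≤-trans p≤0 (ℚₚ.0≤∣p∣ p)

    ∣-∣-sym : ∀ p q → ∣ p ℚ.- q ∣ ≡ ∣ q ℚ.- p ∣
    ∣-∣-sym p q = trans (sym (ℚₚ.∣-p∣≡∣p∣ (p ℚ.- q)))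
      (cong ∣_∣ (solve 2 (λ a b → :- (a :- b) := b :- a) refl p q))

    ≤-by : ∀ {p q} r → 0ℚ ℚ.≤ r → q ≡ p ℚ.+ r → p ℚ.≤ q
    ≤-by {p} r 0≤r eq = subst₂ ℚ._≤_ (ℚₚ.+-identityʳ p) (sym eq) (ℚₚ.+-monoʳ-≤ p 0≤r)

    ≤⇒0≤- : ∀ {p q} → p ℚ.≤ q → 0ℚ ℚ.≤ q ℚ.- p
    ≤⇒0≤- {p} {q} p≤q = subst (ℚ._≤ q ℚ.- p) (ℚₚ.+-inverseʳ p) (ℚₚ.+-monoˡ-≤ (ℚ.- p) p≤q)

    *-nonNeg : ∀ {p q} → 0ℚ ℚ.≤ p → 0ℚ ℚ.≤ q → 0ℚ ℚ.≤ p ℚ.* q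
    *-nonNeg {p} {q} 0≤p 0≤q = subst (ℚ._≤ p ℚ.* q) (ℚₚ.*-zeroʳ p)
      (ℚₚ.*-monoˡ-≤-nonNeg p {{ℚ.nonNegative 0≤p}} 0≤q)

    *-pos : ∀ {p q} → 0ℚ ℚ.< p → 0ℚ ℚ.< q → 0ℚ ℚ.< p ℚ.* q
    *-pos {p} {q} 0<p 0<q = ℚₚ.positive⁻¹ (p ℚ.* q)
      {{ℚₚ.pos*pos⇒pos p {{ℚ.positive 0<p}} q {{ℚ.positive 0<q}}}}

    *-mono-≤ : ∀ {p q r s} → 0ℚ ℚ.≤ r → 0ℚ ℚ.≤ q → p ℚ.≤ q → r ℚ.≤ s →
               p ℚ.* r ℚ.≤ q ℚ.* s
    *-mono-≤ {p} {q} {r} {s} 0≤r 0≤q p≤q r≤s = ℚₚ.≤-trans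
      (ℚₚ.*-monoʳ-≤-nonNeg r {{ℚ.nonNegative 0≤r}} p≤q)
      (ℚₚ.*-monoˡ-≤-nonNeg q {{ℚ.nonNegative 0≤q}} r≤s)

    ∣-∣≤⇒≤+ : ∀ {p q ε} → ∣ p ℚ.- q ∣ ℚ.≤ ε → p ℚ.≤ q ℚ.+ ε
    ∣-∣≤⇒≤+ {p} {q} {ε} h = subst (ℚ._≤ q ℚ.+ ε)
      (solve 2 (λ a b → b :+ (a :- b) := a) refl p q)
      (ℚₚ.+-monoʳ-≤ q (ℚₚ.≤-trans (p≤∣p∣ (p ℚ.- q)) h))

    ≤+⇒∣-∣≤ : ∀ {p q ε} → p ℚ.≤ q ℚ.+ ε → q ℚ.≤ p ℚ.+ ε → ∣ p ℚ.- q ∣ ℚ.≤ ε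
    ≤+⇒∣-∣≤ {p} {q} {ε} h₁ h₂ = ∣∣-lub
      (≤-by _ (≤⇒0≤- h₁) (solve 3 (λ p q e → e := p :- q :+ (q :+ e :- p)) refl p q ε))
      (≤-by _ (≤⇒0≤- h₂) (solve 3 (λ p q e → e := :- (p :- q) :+ (p :+ e :- q)) refl p q ε))

    ½-pos : ∀ {ε} → 0ℚ ℚ.< ε → 0ℚ ℚ.< ½ ℚ.* ε
    ½-pos = *-pos (ℚₚ.positive⁻¹ ½)

    ½+½ : ∀ ε → ½ ℚ.* ε ℚ.+ ½ ℚ.* ε ≡ ε
    ½+½ = solve 1 (λ e → con ½ :* e :+ con ½ :* e := e) refl

    reciprocal : ∀ p → 0ℚ ℚ.< p → ∃[ r ] 0ℚ ℚ.< r × r ℚ.* p ≡ 1ℚ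
    reciprocal p@record{} 0<p =
      ℚ.1/ p , ℚₚ.positive⁻¹ (ℚ.1/ p) {{ℚₚ.1/pos⇒pos p}} , ℚₚ.*-inverseˡ p
      where
      instance
        p-pos : ℚ.Positive p
        p-pos = ℚ.positive 0<p

        p-nonZero : ℚ.NonZero p
        p-nonZero = ℚₚ.pos⇒nonZero p

    divide : ∀ p ε → 0ℚ ℚ.< p → 0ℚ ℚ.< ε → ∃[ δ ] 0ℚ ℚ.< δ × p ℚ.* δ ≡ ε
    divide p ε 0<p 0<ε with reciprocal p 0<p
    ... | r , 0<r , rp≡1 = r ℚ.* ε , *-pos 0<r 0<ε , trans
      (solve 3 (λ p r e → p :* (r :* e) := (r :* p) :* e) refl p r ε)
      (trans (cong (ℚ._* ε) rp≡1) (ℚₚ.*-identityˡ ε))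

    ∣*∣-≤ : ∀ {p q K δ} → ∣ p ∣ ℚ.≤ K → ∣ q ∣ ℚ.≤ δ → ∣ p ℚ.* q ∣ ℚ.≤ K ℚ.* δ
    ∣*∣-≤ {p} {q} p≤K q≤δ = subst (ℚ._≤ _) (sym (ℚₚ.∣p*q∣≡∣p∣*∣q∣ p q))
      (*-mono-≤ (ℚₚ.0≤∣p∣ q) (ℚₚ.≤-trans (ℚₚ.0≤∣p∣ p) p≤K) p≤K q≤δ)

    *-close : ∀ x x′ y y′ {K L δ δ′} → ∣ y ∣ ℚ.≤ K → ∣ x′ ∣ ℚ.≤ L →
      ∣ x ℚ.- x′ ∣ ℚ.≤ δ → ∣ y ℚ.- y′ ∣ ℚ.≤ δ′ →
      ∣ x ℚ.* y ℚ.- x′ ℚ.* y′ ∣ ℚ.≤ K ℚ.* δ ℚ.+ L ℚ.* δ′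
    *-close x x′ y y′ {K} {L} {δ} {δ′} y≤K x′≤L hx hy = begin
      ∣ x ℚ.* y ℚ.- x′ ℚ.* y′ ∣
        ≡⟨ cong ∣_∣ (solve 4 (λ x x′ y y′ → x :* y :- x′ :* y′
             := y :* (x :- x′) :+ x′ :* (y :- y′)) refl x x′ y y′) ⟩
      ∣ y ℚ.* (x ℚ.- x′) ℚ.+ x′ ℚ.* (y ℚ.- y′) ∣
        ≤⟨ ℚₚ.∣p+q∣≤∣p∣+∣q∣ (y ℚ.* (x ℚ.- x′)) (x′ ℚ.* (y ℚ.- y′)) ⟩
      ∣ y ℚ.* (x ℚ.- x′) ∣ ℚ.+ ∣ x′ ℚ.* (y ℚ.- y′) ∣
        ≤⟨ ℚₚ.+-mono-≤ (∣*∣-≤ {y} y≤K hx) (∣*∣-≤ {x′} x′≤L hy) ⟩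
      K ℚ.* δ ℚ.+ L ℚ.* δ′ ∎

    -- Approximants of a nonnegative real may be slightly negative. The product is negative only for
    -- factors of opposite sign; then the negative one is within its tolerance of 0 and the other is
    -- bounded.
    *-nearlyNonNeg : ∀ x y {K L δ δ′} → ∣ x ∣ ℚ.≤ K → ∣ y ∣ ℚ.≤ L →
      0ℚ ℚ.≤ δ → 0ℚ ℚ.≤ δ′ → 0ℚ ℚ.≤ x ℚ.+ δ → 0ℚ ℚ.≤ y ℚ.+ δ′ →
      0ℚ ℚ.≤ x ℚ.* y ℚ.+ (L ℚ.* δ ℚ.+ K ℚ.* δ′)
    *-nearlyNonNeg x y {K} {L} {δ} {δ′} x≤K y≤L 0≤δ 0≤δ′ hx hy
      with ℚₚ.≤-total 0ℚ x | ℚₚ.≤-total 0ℚ y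
    ... | inj₁ 0≤x | inj₁ 0≤y = ℚₚ.+-mono-≤ (*-nonNeg 0≤x 0≤y)
      (ℚₚ.+-mono-≤ (*-nonNeg 0≤L 0≤δ) (*-nonNeg 0≤K 0≤δ′))
      where
      0≤K = ℚₚ.≤-trans (ℚₚ.0≤∣p∣ x) x≤K
      0≤L = ℚₚ.≤-trans (ℚₚ.0≤∣p∣ y) y≤L
    ... | inj₁ 0≤x | inj₂ y≤0 = ≤-by _ (ℚₚ.+-mono-≤ (ℚₚ.+-mono-≤
        (*-nonNeg 0≤x hy) (*-nonNeg (≤⇒0≤- (ℚₚ.≤-trans (p≤∣p∣ x) x≤K)) 0≤δ′))
        (*-nonNeg (ℚₚ.≤-trans (ℚₚ.0≤∣p∣ y) y≤L) 0≤δ))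
      (solve 6 (λ x y k l d d′ → x :* y :+ (l :* d :+ k :* d′)
        := con 0ℚ :+ (x :* (y :+ d′) :+ (k :- x) :* d′ :+ l :* d)) refl x y K L δ δ′)
    ... | inj₂ x≤0 | inj₁ 0≤y = ≤-by _ (ℚₚ.+-mono-≤ (ℚₚ.+-mono-≤
        (*-nonNeg 0≤y hx) (*-nonNeg (≤⇒0≤- (ℚₚ.≤-trans (p≤∣p∣ y) y≤L)) 0≤δ))
        (*-nonNeg (ℚₚ.≤-trans (ℚₚ.0≤∣p∣ x) x≤K) 0≤δ′))
      (solve 6 (λ x y k l d d′ → x :* y :+ (l :* d :+ k :* d′)
        := con 0ℚ :+ (y :* (x :+ d) :+ (l :- y) :* d :+ k :* d′)) refl x y K L δ δ′)
    ... | inj₂ x≤0 | inj₂ y≤0 = ≤-by _ (ℚₚ.+-mono-≤ (*-nonNeg (≤⇒0≤- x≤0) (≤⇒0≤- y≤0))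
        (ℚₚ.+-mono-≤ (*-nonNeg (ℚₚ.≤-trans (ℚₚ.0≤∣p∣ y) y≤L) 0≤δ)
                     (*-nonNeg (ℚₚ.≤-trans (ℚₚ.0≤∣p∣ x) x≤K) 0≤δ′)))
      (solve 6 (λ x y k l d d′ → x :* y :+ (l :* d :+ k :* d′)
        := con 0ℚ :+ ((con 0ℚ :- x) :* (con 0ℚ :- y) :+ (l :* d :+ k :* d′)))
        refl x y K L δ δ′)

    toℚᵘ-fromℕ : ∀ n → ℚ.toℚᵘ (fromℕ n) ℚᵘ.≃ ℚᵘ.mkℚᵘ (+ n) 0
    toℚᵘ-fromℕ zero    = ℚᵘₚ.≃-refl
    toℚᵘ-fromℕ (suc n) = ℚᵘₚ.≃-trans (ℚₚ.toℚᵘ-homo-+ 1ℚ (fromℕ n))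
      (ℚᵘₚ.≃-trans (ℚᵘₚ.+-congʳ (ℚ.toℚᵘ 1ℚ) (toℚᵘ-fromℕ n))
        (ℚᵘ.*≡* (cong (ℤ._* + 1) (cong (λ k → + 1 ℤ.+ k) (ℤₚ.*-identityʳ (+ n))))))

    ℚ-archimedean : ∀ q → ∃[ n ] q ℚ.≤ fromℕ n
    ℚ-archimedean q = ℤ.∣ ℚ.↥ q ∣ , ℚₚ.toℚᵘ-cancel-≤ (ℚᵘₚ.≤-respʳ-≃
      (ℚᵘₚ.≃-sym (toℚᵘ-fromℕ ℤ.∣ ℚ.↥ q ∣)) (bound q))
      where
      i≤∣i∣ : ∀ i → i ℤ.≤ + ℤ.∣ i ∣
      i≤∣i∣ (+ n)        = ℤₚ.≤-refl
      i≤∣i∣ (ℤ.-[1+ n ]) = ℤ.-≤+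

      bound : ∀ q → ℚ.toℚᵘ q ℚᵘ.≤ ℚᵘ.mkℚᵘ (+ ℤ.∣ ℚ.↥ q ∣) 0
      bound (ℚ.mkℚ i d _) = ℚᵘ.*≤* (ℤₚ.≤-trans
        (ℤₚ.≤-reflexive (ℤₚ.*-identityʳ i))
        (ℤₚ.≤-trans (i≤∣i∣ i) (ℤₚ.≤-trans (ℤ.+≤+ (ℕₚ.m≤m*n ℤ.∣ i ∣ (suc d)))
          (ℤₚ.≤-reflexive (ℤₚ.pos-* ℤ.∣ i ∣ (suc d))))))

    step≤ : ∀ {δ} → 0ℚ ℚ.< δ → ∀ n → ℚ.↧ₙ δ ℕ.≤ n → step n ℚ.≤ δ
    step≤ {δ} 0<δ n h = ℚₚ.toℚᵘ-cancel-≤ (bound δ (ℚ.positive 0<δ) h)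
      where
      bound : ∀ δ → ℚ.Positive δ → ℚ.↧ₙ δ ℕ.≤ n → ℚᵘ.mkℚᵘ (+ 1) n ℚᵘ.≤ ℚ.toℚᵘ δ
      bound (ℚ.mkℚ ℤ.+[1+ p ] d _) _ h = ℚᵘ.*≤* (ℤ.+≤+ (ℕₚ.≤-trans
        (ℕₚ.≤-reflexive (ℕₚ.*-identityˡ (suc d)))
        (ℕₚ.≤-trans (ℕₚ.m≤n⇒m≤1+n h) (ℕₚ.m≤n*m (suc n) (suc p)))))

  open ℚ-Estimates

-- Real numbers

Eventually : (ℕ → Set) → Set
Eventually P = ∃[ N ] ∀ n → N ℕ.≤ n → P n

always : ∀ {P} → (∀ n → P n) → Eventually P
always p = 0 , λ n _ → p n

map-eventually : ∀ {P Q : ℕ → Set} → (∀ n → P n → Q n) → Eventually P → Eventually Q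
map-eventually f (N , p) = N , λ n N≤n → f n (p n N≤n)

both : ∀ {P Q} → Eventually P → Eventually Q → Eventually (λ n → P n × Q n)
both (M , p) (N , q) = M ℕ.⊔ N , λ n ≤n →
  p n (ℕₚ.m⊔n≤o⇒m≤o M N ≤n) , q n (ℕₚ.m⊔n≤o⇒n≤o M N ≤n)

pointwise-≤ : ∀ x y → (∀ n → seq x n ℚ.≤ seq y n) → x ≤ y
pointwise-≤ x y h ε 0<ε = always λ n →
  ℚₚ.≤-trans (h n) (≤-by ε (ℚₚ.<⇒≤ 0<ε) refl)

pointwise-≈ : ∀ x y → (∀ n → seq x n ≡ seq y n) → x ≈ y
pointwise-≈ x y h ε 0<ε = always λ n → subst (ℚ._≤ ε)
  (sym (trans (cong (λ p → ∣ p ℚ.- seq y n ∣) (h n)) (cong ∣_∣ (ℚₚ.+-inverseʳ (seq y n)))))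
  (ℚₚ.<⇒≤ 0<ε)

≈⇒≤ : ∀ x y → x ≈ y → x ≤ y
≈⇒≤ x y h ε 0<ε = map-eventually (λ n → ∣-∣≤⇒≤+) (h ε 0<ε)

≤-antisym : ∀ x y → x ≤ y → y ≤ x → x ≈ y
≤-antisym x y h h′ ε 0<ε =
  map-eventually (λ n (p , q) → ≤+⇒∣-∣≤ p q) (both (h ε 0<ε) (h′ ε 0<ε))

≤-trans : ∀ x y z → x ≤ y → y ≤ z → x ≤ z
≤-trans x y z h h′ ε 0<ε = map-eventually
  (λ n (p , q) → ℚₚ.≤-trans p (ℚₚ.≤-trans (ℚₚ.+-monoˡ-≤ (½ ℚ.* ε) q)
    (ℚₚ.≤-reflexive (trans (ℚₚ.+-assoc (seq z n) (½ ℚ.* ε) (½ ℚ.* ε))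
      (cong (seq z n ℚ.+_) (½+½ ε))))))
  (both (h _ (½-pos 0<ε)) (h′ _ (½-pos 0<ε)))

≈-refl : ∀ x → x ≈ x
≈-refl x = pointwise-≈ x x λ _ → refl

≈-sym : ∀ x y → x ≈ y → y ≈ x
≈-sym x y h ε 0<ε = map-eventually
  (λ n → subst (ℚ._≤ ε) (∣-∣-sym (seq x n) (seq y n))) (h ε 0<ε)

≈-trans : ∀ x y z → x ≈ y → y ≈ z → x ≈ z
≈-trans x y z x≈y y≈z = ≤-antisym x z
  (≤-trans x y z (≈⇒≤ x y x≈y) (≈⇒≤ y z y≈z))
  (≤-trans z y x (≈⇒≤ z y (≈-sym y z y≈z)) (≈⇒≤ y x (≈-sym x y x≈y)))

+-mono-≤ : ∀ w x y z → w ≤ x → y ≤ z → w + y ≤ x + z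
+-mono-≤ w x y z h h′ ε 0<ε = map-eventually
  (λ n (p , q) → ℚₚ.≤-trans (ℚₚ.+-mono-≤ p q) (ℚₚ.≤-reflexive
    (solve 3 (λ x z e → (x :+ con ½ :* e) :+ (z :+ con ½ :* e) := x :+ z :+ e) refl
      (seq x n) (seq z n) ε)))
  (both (h _ (½-pos 0<ε)) (h′ _ (½-pos 0<ε)))
  where open +-*-Solver

+-cong : ∀ w x y z → w ≈ x → y ≈ z → w + y ≈ x + z
+-cong w x y z h h′ = ≤-antisym (w + y) (x + z)
  (+-mono-≤ w x y z (≈⇒≤ w x h) (≈⇒≤ y z h′))
  (+-mono-≤ x w z y (≈⇒≤ x w (≈-sym w x h)) (≈⇒≤ z y (≈-sym y z h′)))

-‿cong : ∀ x y → x ≈ y → - x ≈ - y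
-‿cong x y h ε 0<ε = map-eventually
  (λ n → subst (ℚ._≤ ε) (trans (∣-∣-sym (seq x n) (seq y n))
    (cong ∣_∣ (solve 2 (λ a b → b :- a := :- a :- (:- b)) refl (seq x n) (seq y n)))))
  (h ε 0<ε)
  where open +-*-Solver

bounded : ∀ x → ∃[ K ] 0ℚ ℚ.< K × Eventually (λ n → ∣ seq x n ∣ ℚ.≤ K)
bounded x with cauchy x 1ℚ (ℚₚ.positive⁻¹ 1ℚ)
... | N , h = ∣ seq x N ∣ ℚ.+ 1ℚ
  , ℚₚ.+-mono-≤-< (ℚₚ.0≤∣p∣ (seq x N)) (ℚₚ.positive⁻¹ 1ℚ)
  , N , λ n N≤n → begin
      ∣ seq x n ∣
        ≡⟨ cong ∣_∣ (solve 2 (λ a b → a := b :+ (a :- b)) refl (seq x n) (seq x N)) ⟩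
      ∣ seq x N ℚ.+ (seq x n ℚ.- seq x N) ∣
        ≤⟨ ℚₚ.∣p+q∣≤∣p∣+∣q∣ (seq x N) (seq x n ℚ.- seq x N) ⟩
      ∣ seq x N ∣ ℚ.+ ∣ seq x n ℚ.- seq x N ∣
        ≤⟨ ℚₚ.+-monoʳ-≤ ∣ seq x N ∣ (h n N N≤n ℕₚ.≤-refl) ⟩
      ∣ seq x N ∣ ℚ.+ 1ℚ ∎
  where
  open +-*-Solver
  open ℚₚ.≤-Reasoning

*-cong : ∀ w x y z → w ≈ x → y ≈ z → w * y ≈ x * z
*-cong w x y z h h′ ε 0<ε =
  let (K , 0<K , y≤K) = bounded y
      (L , 0<L , x≤L) = bounded x
      (δ , 0<δ , Kδ≡) = divide K (½ ℚ.* ε) 0<K (½-pos 0<ε)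
      (δ′ , 0<δ′ , Lδ′≡) = divide L (½ ℚ.* ε) 0<L (½-pos 0<ε)
  in map-eventually
    (λ n ((y≤K , x≤L) , (p , q)) → subst (∣ seq w n ℚ.* seq y n ℚ.- seq x n ℚ.* seq z n ∣ ℚ.≤_)
      (trans (cong₂ ℚ._+_ Kδ≡ Lδ′≡) (½+½ ε))
      (*-close (seq w n) (seq x n) (seq y n) (seq z n) y≤K x≤L p q))
    (both (both y≤K x≤L) (both (h δ 0<δ) (h′ δ′ 0<δ′)))

0≤* : ∀ x y → 0ℝ ≤ x → 0ℝ ≤ y → 0ℝ ≤ x * y
0≤* x y h h′ ε 0<ε =
  let (K , 0<K , x≤K) = bounded x
      (L , 0<L , y≤L) = bounded y
      (δ , 0<δ , Lδ≡) = divide L (½ ℚ.* ε) 0<L (½-pos 0<ε)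
      (δ′ , 0<δ′ , Kδ′≡) = divide K (½ ℚ.* ε) 0<K (½-pos 0<ε)
  in map-eventually
    (λ n ((x≤K , y≤L) , (p , q)) → subst (λ e → 0ℚ ℚ.≤ seq x n ℚ.* seq y n ℚ.+ e)
      (trans (cong₂ ℚ._+_ Lδ≡ Kδ′≡) (½+½ ε))
      (*-nearlyNonNeg (seq x n) (seq y n) x≤K y≤L (ℚₚ.<⇒≤ 0<δ) (ℚₚ.<⇒≤ 0<δ′) p q))
    (both (both x≤K y≤L) (both (h δ 0<δ) (h′ δ′ 0<δ′)))

<⇒≤ : ∀ x y → x < y → x ≤ y
<⇒≤ x y (g , 0<g , h) ε 0<ε = map-eventually
  (λ n x+g≤y → ℚₚ.≤-trans (≤-by g (ℚₚ.<⇒≤ 0<g) refl)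
    (ℚₚ.≤-trans x+g≤y (≤-by ε (ℚₚ.<⇒≤ 0<ε) refl))) h

<⇒≱ : ∀ x y → x < y → ¬ (y ≤ x)
<⇒≱ x y (ε , 0<ε , h) y≤x with both h (y≤x _ (½-pos 0<ε))
... | N , p with p N ℕₚ.≤-refl
... | x+ε≤y , y≤x+½ε = ℚₚ.<-irrefl refl (ℚₚ.<-≤-trans (½-pos 0<ε)
  (≤-by _ (≤⇒0≤- (ℚₚ.≤-trans x+ε≤y y≤x+½ε))
    (solve 2 (λ x e → con 0ℚ := con ½ :* e :+ ((x :+ con ½ :* e) :- (x :+ e)))
      refl (seq x N) ε)))
  where open +-*-Solver

-- One rational comparison, at an index past which both sequences move by at most `q = ε/8`, settles
-- the order up to `ε`. A gap of at most 3q grows to at most 5q under the two drifts, still below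
-- `ε`; a larger gap keeps at least `q`, which witnesses `x < y`.
≮⇒≥ : ∀ x y → ¬ (x < y) → y ≤ x
≮⇒≥ x y x≮y ε 0<ε = compare (both′ (cauchy x q 0<q) (cauchy y q 0<q))
  where
  open +-*-Solver
  q = ½ ℚ.* (½ ℚ.* (½ ℚ.* ε))
  0<q = ½-pos (½-pos (½-pos 0<ε))
  0≤q = ℚₚ.<⇒≤ 0<q

  Near : ℕ → ℕ → Set
  Near N n = (seq x N ℚ.≤ seq x n ℚ.+ q × seq x n ℚ.≤ seq x N ℚ.+ q) ×
             (seq y N ℚ.≤ seq y n ℚ.+ q × seq y n ℚ.≤ seq y N ℚ.+ q)

  both′ : ∃[ M ] (∀ m n → M ℕ.≤ m → M ℕ.≤ n → ∣ seq x m ℚ.- seq x n ∣ ℚ.≤ q) →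
          ∃[ M ] (∀ m n → M ℕ.≤ m → M ℕ.≤ n → ∣ seq y m ℚ.- seq y n ∣ ℚ.≤ q) →
          ∃[ N ] (∀ n → N ℕ.≤ n → Near N n)
  both′ (M , p) (M′ , p′) = N , λ n N≤n →
    let M≤n  = ℕₚ.≤-trans M≤N N≤n
        M′≤n = ℕₚ.≤-trans M′≤N N≤n
    in (∣-∣≤⇒≤+ (p N n M≤N M≤n) , ∣-∣≤⇒≤+ (p n N M≤n M≤N)) ,
       (∣-∣≤⇒≤+ (p′ N n M′≤N M′≤n) , ∣-∣≤⇒≤+ (p′ n N M′≤n M′≤N))
    where
    N = M ℕ.⊔ M′
    M≤N = ℕₚ.m≤m⊔n M M′
    M′≤N = ℕₚ.m≤n⊔m M M′

  compare : ∃[ N ] (∀ n → N ℕ.≤ n → Near N n) → Eventually (λ n → seq y n ℚ.≤ seq x n ℚ.+ ε)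
  compare (N , near) with seq y N ℚ.≤? seq x N ℚ.+ (q ℚ.+ q ℚ.+ q)
  ... | yes y≤x+3q = N , λ n N≤n → let ((x≤ , _) , (_ , y≤)) = near n N≤n in
    ≤-by _ (ℚₚ.+-mono-≤ (ℚₚ.+-mono-≤ (≤⇒0≤- x≤) (≤⇒0≤- y≤))
        (ℚₚ.+-mono-≤ (≤⇒0≤- y≤x+3q) (ℚₚ.+-mono-≤ 0≤q (ℚₚ.+-mono-≤ 0≤q 0≤q))))
      (solve 5 (λ e x X y Y →
        let q = con ½ :* (con ½ :* (con ½ :* e)) in
        x :+ e := y :+ (((x :+ q :- X) :+ (Y :+ q :- y))
          :+ ((X :+ (q :+ q :+ q) :- Y) :+ (q :+ (q :+ q))))) refl
        ε (seq x n) (seq x N) (seq y n) (seq y N))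
  ... | no y≰x+3q = contradiction (q , 0<q , N , λ n N≤n →
    let ((_ , x≤) , (y≤ , _)) = near n N≤n in
    ≤-by _ (ℚₚ.+-mono-≤ (ℚₚ.+-mono-≤ (≤⇒0≤- x≤) (≤⇒0≤- y≤))
        (≤⇒0≤- (ℚₚ.<⇒≤ (ℚₚ.≰⇒> y≰x+3q))))
      (solve 5 (λ q x X y Y → y := (x :+ q) :+ (((X :+ q :- x) :+ (y :+ q :- Y))
        :+ (Y :- (X :+ (q :+ q :+ q))))) refl
        q (seq x n) (seq x N) (seq y n) (seq y N))) x≮y

-- The value for q ≤ 0 is junk.
recip : ℚ → ℚ
recip q with 0ℚ ℚ.<? q
... | yes 0<q = proj₁ (reciprocal q 0<q)
... | no  _   = 0ℚ

recip-spec : ∀ q → 0ℚ ℚ.< q → 0ℚ ℚ.< recip q × recip q ℚ.* q ≡ 1ℚ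
recip-spec q 0<q with 0ℚ ℚ.<? q
... | yes 0<q′ = proj₂ (reciprocal q 0<q′)
... | no  0≮q  = contradiction 0<q 0≮q

-- 1/a - 1/b = (b - a)/(ab), and `E`, the reciprocal of the lower bound `g`, bounds both 1/a and
-- 1/b.
recip-close : ∀ {g E δ} a b → 0ℚ ℚ.< g → 0ℚ ℚ.≤ E → E ℚ.* g ≡ 1ℚ →
  g ℚ.≤ a → g ℚ.≤ b → ∣ a ℚ.- b ∣ ℚ.≤ δ → ∣ recip a ℚ.- recip b ∣ ℚ.≤ E ℚ.* E ℚ.* δ
recip-close {g} {E} {δ} a b 0<g 0≤E Eg≡1 g≤a g≤b h = begin
  ∣ recip a ℚ.- recip b ∣
    ≡⟨ cong ∣_∣ eq ⟩
  ∣ recip a ℚ.* recip b ℚ.* (b ℚ.- a) ∣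
    ≤⟨ ∣*∣-≤ {recip a ℚ.* recip b} (∣*∣-≤ {recip a} (recip≤ a g≤a) (recip≤ b g≤b))
         (subst (ℚ._≤ δ) (∣-∣-sym a b) h) ⟩
  E ℚ.* E ℚ.* δ ∎
  where
  open +-*-Solver
  open ℚₚ.≤-Reasoning

  recip≤ : ∀ a → g ℚ.≤ a → ∣ recip a ∣ ℚ.≤ E
  recip≤ a g≤a with recip-spec a (ℚₚ.<-≤-trans 0<g g≤a)
  ... | 0<r , ra≡1 = subst (ℚ._≤ E) (sym (ℚₚ.0≤p⇒∣p∣≡p (ℚₚ.<⇒≤ 0<r))) (≤-by
    (recip a ℚ.* E ℚ.* (a ℚ.- g)) (*-nonNeg (*-nonNeg (ℚₚ.<⇒≤ 0<r) 0≤E) (≤⇒0≤- g≤a))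
    (sym (trans
      (solve 4 (λ r e a g → r :+ r :* e :* (a :- g) := r :+ ((r :* a) :* e :- (e :* g) :* r))
        refl (recip a) E a g)
      (trans (cong₂ (λ s t → recip a ℚ.+ (s ℚ.* E ℚ.- t ℚ.* recip a)) ra≡1 Eg≡1)
        (solve 2 (λ r e → r :+ (con 1ℚ :* e :- con 1ℚ :* r) := e) refl (recip a) E)))))

  eq : recip a ℚ.- recip b ≡ recip a ℚ.* recip b ℚ.* (b ℚ.- a)
  eq = sym (trans
    (solve 4 (λ r s a b → r :* s :* (b :- a) := r :* (s :* b) :- s :* (r :* a))
      refl (recip a) (recip b) a b)
    (trans (cong₂ (λ s t → recip a ℚ.* s ℚ.- recip b ℚ.* t)
        (proj₂ (recip-spec b (ℚₚ.<-≤-trans 0<g g≤b)))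
        (proj₂ (recip-spec a (ℚₚ.<-≤-trans 0<g g≤a))))
      (solve 2 (λ r s → r :* con 1ℚ :- s :* con 1ℚ := r :- s) refl (recip a) (recip b))))

positive-inverse : ∀ x → 0ℝ < x → ∃[ y ] y * x ≈ fromℚ 1ℚ
positive-inverse x (g , 0<g , N , h) = y , λ ε 0<ε → N , λ n N≤n →
  subst (λ p → ∣ p ℚ.- 1ℚ ∣ ℚ.≤ ε)
    (sym (proj₂ (recip-spec (seq x n) (ℚₚ.<-≤-trans 0<g (g≤ n N≤n))))) (ℚₚ.<⇒≤ 0<ε)
  where
  E = proj₁ (reciprocal g 0<g)
  0<E = proj₁ (proj₂ (reciprocal g 0<g))

  g≤ : ∀ n → N ℕ.≤ n → g ℚ.≤ seq x n
  g≤ n N≤n = subst (ℚ._≤ seq x n) (ℚₚ.+-identityˡ g) (h n N≤n)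

  recip-cauchy : IsCauchy (λ n → recip (seq x n))
  recip-cauchy ε 0<ε =
    let (δ , 0<δ , EEδ≡ε) = divide (E ℚ.* E) ε (*-pos 0<E 0<E) 0<ε
        (M , p) = cauchy x δ 0<δ
    in M ℕ.⊔ N , λ m n ≤m ≤n →
      subst (∣ recip (seq x m) ℚ.- recip (seq x n) ∣ ℚ.≤_) EEδ≡ε
        (recip-close (seq x m) (seq x n) 0<g (ℚₚ.<⇒≤ 0<E) (proj₂ (proj₂ (reciprocal g 0<g)))
          (g≤ m (ℕₚ.m⊔n≤o⇒n≤o M N ≤m)) (g≤ n (ℕₚ.m⊔n≤o⇒n≤o M N ≤n))
          (p m n (ℕₚ.m⊔n≤o⇒m≤o M N ≤m) (ℕₚ.m⊔n≤o⇒m≤o M N ≤n)))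

  y : ℝ
  y = mkℝ (λ n → recip (seq x n)) recip-cauchy

-- Square roots of reals

0≤√ : ∀ x → 0ℝ ≤ √ x
0≤√ x = pointwise-≤ 0ℝ (√ x) λ n → proj₁ (root-spec n (seq x n))

√-square : ∀ x → 0ℝ ≤ x → √ x * √ x ≈ x
√-square x 0≤x = ≤-antisym (√ x * √ x) x upper lower
  where
  upper : √ x * √ x ≤ x
  upper ε 0<ε = map-eventually below (0≤x ε 0<ε)
    where
    below : ∀ n → 0ℚ ℚ.≤ seq x n ℚ.+ ε →
      root n (seq x n) ℚ.* root n (seq x n) ℚ.≤ seq x n ℚ.+ ε
    below n 0≤ with proj₁ (proj₂ (root-spec n (seq x n)))
    -- The root is also 0 at negative arguments; the near-nonnegativity of `seq x n` controls that
    -- case.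
    ... | inj₁ a≡0 = subst (λ a → a ℚ.* a ℚ.≤ seq x n ℚ.+ ε) (sym a≡0) 0≤
    ... | inj₂ a²≤ = ℚₚ.≤-trans a²≤ (≤-by ε (ℚₚ.<⇒≤ 0<ε) refl)

  small-steps : ∀ δ → 0ℚ ℚ.< δ → Eventually (λ n → step n ℚ.≤ δ)
  small-steps δ 0<δ = ℚ.↧ₙ δ , step≤ 0<δ

  lower : x ≤ √ x * √ x
  lower ε 0<ε =
    let (K , 0<K , a≤K) = bounded (√ x)
        -- (a + s)² - a² = s(2a + s) is at most Cδ once a ≤ K, s ≤ δ and s ≤ 1.
        C = K ℚ.+ K ℚ.+ 1ℚ
        (δ , 0<δ , Cδ≡ε) = divide C ε
          (ℚₚ.+-mono-< (ℚₚ.+-mono-< 0<K 0<K) (ℚₚ.positive⁻¹ 1ℚ)) 0<ε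
    in map-eventually
      (λ n (a≤K , (s≤δ , s≤1)) →
        let a = root n (seq x n)
            s = step n
            0≤s = ℚₚ.<⇒≤ (ℚₚ.positive⁻¹ s)
            0≤K-a = ≤⇒0≤- (ℚₚ.≤-trans (p≤∣p∣ a) a≤K)
        in ℚₚ.≤-trans (ℚₚ.<⇒≤ (proj₂ (proj₂ (root-spec n (seq x n)))))
          (subst (λ e → (a ℚ.+ s) ℚ.* (a ℚ.+ s) ℚ.≤ a ℚ.* a ℚ.+ e) Cδ≡ε (≤-by _
            (ℚₚ.+-mono-≤
              (*-nonNeg (ℚₚ.+-mono-≤ (ℚₚ.+-mono-≤ (ℚₚ.<⇒≤ 0<K) (ℚₚ.<⇒≤ 0<K))
                (ℚₚ.<⇒≤ (ℚₚ.positive⁻¹ 1ℚ))) (≤⇒0≤- s≤δ))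
              (*-nonNeg 0≤s (ℚₚ.+-mono-≤ (ℚₚ.+-mono-≤ 0≤K-a 0≤K-a) (≤⇒0≤- s≤1))))
            (solve 4 (λ a s k d → a :* a :+ (k :+ k :+ con 1ℚ) :* d
              := (a :+ s) :* (a :+ s) :+ ((k :+ k :+ con 1ℚ) :* (d :- s)
                :+ s :* ((k :- a) :+ (k :- a) :+ (con 1ℚ :- s)))) refl a s K δ))))
      (both a≤K (both (small-steps δ 0<δ) (small-steps 1ℚ (ℚₚ.positive⁻¹ 1ℚ))))
    where open +-*-Solver

infixl 6 _⊕_
infixl 7 _⊗_
infix  8 ⊝_

-- Opaque copies of the operations: comparing two reals built with the original
-- ones unfolds their Cauchy proofs.
abstract
  _⊕_ _⊗_ : ℝ → ℝ → ℝ
  _⊕_ = _+_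
  _⊗_ = _*_

  ⊝_ : ℝ → ℝ
  ⊝_ = -_

  +≈⊕ : ∀ w x y z → w ≈ x → y ≈ z → w + y ≈ x ⊕ z
  +≈⊕ = +-cong

  *≈⊗ : ∀ w x y z → w ≈ x → y ≈ z → w * y ≈ x ⊗ z
  *≈⊗ = *-cong

  -≈⊝ : ∀ x y → x - y ≈ x ⊕ ⊝ y
  -≈⊝ x y = ≈-refl (x - y)

  ι-⊕ : ∀ p q → fromℚ (p ℚ.+ q) ≈ fromℚ p ⊕ fromℚ q
  ι-⊕ p q = pointwise-≈ (fromℚ (p ℚ.+ q)) (fromℚ p + fromℚ q) λ _ → refl

  ι-⊗ : ∀ p q → fromℚ (p ℚ.* q) ≈ fromℚ p ⊗ fromℚ q
  ι-⊗ p q = pointwise-≈ (fromℚ (p ℚ.* q)) (fromℚ p * fromℚ q) λ _ → refl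

  ι-⊝ : ∀ p → fromℚ (ℚ.- p) ≈ ⊝ fromℚ p
  ι-⊝ p = pointwise-≈ (fromℚ (ℚ.- p)) (- fromℚ p) λ _ → refl

  ⊕-mono-≤ : ∀ w x y z → w ≤ x → y ≤ z → w ⊕ y ≤ x ⊕ z
  ⊕-mono-≤ = +-mono-≤

  0≤⊗ : ∀ x y → 0ℝ ≤ x → 0ℝ ≤ y → 0ℝ ≤ x ⊗ y
  0≤⊗ = 0≤*

  ⊗-inverse : ∀ x → 0ℝ < x → ∃[ y ] y ⊗ x ≈ fromℚ 1ℚ
  ⊗-inverse = positive-inverse

  ℝ-isCommutativeRing : IsCommutativeRing _≈_ _⊕_ _⊗_ ⊝_ (fromℚ 0ℚ) (fromℚ 1ℚ)
  ℝ-isCommutativeRing = record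
    { isRing = record
      { +-isAbelianGroup = record
        { isGroup = record
          { isMonoid = record
            { isSemigroup = record
              { isMagma = record
                { isEquivalence = record
                  { refl  = λ {x} → ≈-refl x
                  ; sym   = λ {x} {y} → ≈-sym x y
                  ; trans = λ {x} {y} {z} → ≈-trans x y z
                  }
                ; ∙-cong = λ {w} {x} {y} {z} → +-cong w x y z
                }
              ; assoc = λ x y z → pointwise-≈ ((x + y) + z) (x + (y + z)) λ n →
                  ℚₚ.+-assoc (seq x n) (seq y n) (seq z n)
              }
            ; identity =
                (λ x → pointwise-≈ (0ℝ + x) x λ n → ℚₚ.+-identityˡ (seq x n)) ,
                (λ x → pointwise-≈ (x + 0ℝ) x λ n → ℚₚ.+-identityʳ (seq x n))
            }
          ; inverse =
              (λ x → pointwise-≈ (- x + x) 0ℝ λ n → ℚₚ.+-inverseˡ (seq x n)) ,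
              (λ x → pointwise-≈ (x + - x) 0ℝ λ n → ℚₚ.+-inverseʳ (seq x n))
          ; ⁻¹-cong = λ {x} {y} → -‿cong x y
          }
        ; comm = λ x y → pointwise-≈ (x + y) (y + x) λ n → ℚₚ.+-comm (seq x n) (seq y n)
        }
      ; *-cong = λ {w} {x} {y} {z} → *-cong w x y z
      ; *-assoc = λ x y z → pointwise-≈ ((x * y) * z) (x * (y * z)) λ n →
          ℚₚ.*-assoc (seq x n) (seq y n) (seq z n)
      ; *-identity =
          (λ x → pointwise-≈ (fromℚ 1ℚ * x) x λ n → ℚₚ.*-identityˡ (seq x n)) ,
          (λ x → pointwise-≈ (x * fromℚ 1ℚ) x λ n → ℚₚ.*-identityʳ (seq x n))
      ; distrib =
          (λ x y z → pointwise-≈ (x * (y + z)) (x * y + x * z) λ n →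
            ℚₚ.*-distribˡ-+ (seq x n) (seq y n) (seq z n)) ,
          (λ x y z → pointwise-≈ ((y + z) * x) (y * x + z * x) λ n →
            ℚₚ.*-distribʳ-+ (seq x n) (seq y n) (seq z n))
      }
    ; *-comm = λ x y → pointwise-≈ (x * y) (y * x) λ n → ℚₚ.*-comm (seq x n) (seq y n)
    }

ℝ-archimedeanField : ArchimedeanField
ℝ-archimedeanField = record
  { Carrier           = ℝ
  ; _≈_               = _≈_
  ; _≤_               = _≤_
  ; _+_               = _⊕_
  ; _*_               = _⊗_
  ; -_                = ⊝_
  ; ι                 = fromℚ
  ; isCommutativeRing = ℝ-isCommutativeRing
  ; ι-+               = ι-⊕
  ; ι-*               = ι-⊗
  ; ι-neg             = ι-⊝
  ; isPartialOrder    = record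
    { isPreorder = record
      { isEquivalence = IsCommutativeRing.isEquivalence ℝ-isCommutativeRing
      ; reflexive     = λ {x} {y} → ≈⇒≤ x y
      ; trans         = λ {x} {y} {z} → ≤-trans x y z
      }
    ; antisym    = λ {x} {y} → ≤-antisym x y
    }
  ; +-mono-≤          = λ {w} {x} {y} {z} → ⊕-mono-≤ w x y z
  ; *-nonNeg          = λ {x} {y} → 0≤⊗ x y
  ; ≤-stable          = λ {x} {y} ¬¬x≤y → ≮⇒≥ y x λ y<x → ¬¬x≤y (<⇒≱ y x y<x)
  ; ≰⇒≥               = λ {x} {y} x≰y → ≮⇒≥ x y λ x<y → x≰y (<⇒≤ x y x<y)
  ; archimedean       = λ x →
      let (K , _ , x≤K) = bounded x
          (n , K≤n)     = ℚ-archimedean K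
      in n , λ ε 0<ε → map-eventually
        (λ k h → ℚₚ.≤-trans (p≤∣p∣ (seq x k)) (ℚₚ.≤-trans h
          (ℚₚ.≤-trans K≤n (≤-by ε (ℚₚ.<⇒≤ 0<ε) refl)))) x≤K
  ; inverse           = λ {x} x≰0 k → x≰0 (≮⇒≥ 0ℝ x λ 0<x → k (⊗-inverse x 0<x))
  }

module G = Geometry ℝ-archimedeanField

-- Distances

sumOfSquares : ∀ {n} → ℝ^ n → ℝ
sumOfSquares = foldr (λ a s → a * a + s) 0ℝ

sumOfSquares≈dot : ∀ {n} (u v : ℝ^ n) → u ≈ᵛ v → sumOfSquares u ≈ G.dot v v
sumOfSquares≈dot {zero}  u v u≈v = ≈-refl 0ℝ
sumOfSquares≈dot {suc n} u v u≈v =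
  +≈⊕ (head u * head u) (head v ⊗ head v) (sumOfSquares (tail u)) (G.dot (tail v) (tail v))
    (*≈⊗ (head u) (head v) (head u) (head v) (u≈v zero) (u≈v zero))
    (sumOfSquares≈dot (tail u) (tail v) (λ i → u≈v (suc i)))

√-⊗ : ∀ x → 0ℝ ≤ x → √ x ⊗ √ x ≈ x
√-⊗ x 0≤x = ≈-trans (√ x ⊗ √ x) (√ x * √ x) x
  (≈-sym (√ x * √ x) (√ x ⊗ √ x)
    (*≈⊗ (√ x) (√ x) (√ x) (√ x) (≈-refl (√ x)) (≈-refl (√ x))))
  (√-square x 0≤x)

0≤dist : ∀ {n} (v w : ℝ^ n) → 0ℝ ≤ dist v w
0≤dist v w = 0≤√ (sumOfSquares (λ i → v i - w i))

dist-square : ∀ {n} (v w : ℝ^ n) → dist v w ⊗ dist v w ≈ G.sqDist v w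
dist-square v w = ≈-trans (√ s ⊗ √ s) s (G.sqDist v w)
  (√-⊗ s (≤-trans 0ℝ (G.sqDist v w) s (G.dot-nonNeg (v G.⊖ w))
    (≈⇒≤ (G.sqDist v w) s (≈-sym s (G.sqDist v w) s≈))))
  s≈
  where
  s = sumOfSquares (λ i → v i - w i)
  s≈ = sumOfSquares≈dot (λ i → v i - w i) (v G.⊖ w) (λ i → -≈⊝ (v i) (w i))

sqDist⇒dist-≤ : ∀ {m n} (v w : ℝ^ m) (v′ w′ : ℝ^ n) →
  G.sqDist v w ≈ G.sqDist v′ w′ → dist v w ≤ dist v′ w′
sqDist⇒dist-≤ v w v′ w′ eq =
  G.square-cancel-≤ {dist v w} {dist v′ w′} (0≤dist v′ w′)
    (≈⇒≤ (dist v w ⊗ dist v w) (dist v′ w′ ⊗ dist v′ w′)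
      (≈-trans (dist v w ⊗ dist v w) (G.sqDist v w) (dist v′ w′ ⊗ dist v′ w′) (dist-square v w)
        (≈-trans (G.sqDist v w) (G.sqDist v′ w′) (dist v′ w′ ⊗ dist v′ w′) eq
          (≈-sym (dist v′ w′ ⊗ dist v′ w′) (G.sqDist v′ w′) (dist-square v′ w′)))))

sqDist⇒dist : ∀ {m n} (v w : ℝ^ m) (v′ w′ : ℝ^ n) →
  G.sqDist v w ≈ G.sqDist v′ w′ → dist v w ≈ dist v′ w′
sqDist⇒dist v w v′ w′ eq = ≤-antisym (dist v w) (dist v′ w′)
  (sqDist⇒dist-≤ v w v′ w′ eq)
  (sqDist⇒dist-≤ v′ w′ v w (≈-sym (G.sqDist v w) (G.sqDist v′ w′) eq))

dist⇒sqDist : ∀ {m n} (v w : ℝ^ m) (v′ w′ : ℝ^ n) →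
  dist v w ≈ dist v′ w′ → G.sqDist v w ≈ G.sqDist v′ w′
dist⇒sqDist v w v′ w′ eq =
  ≈-trans (G.sqDist v w) (dist v w ⊗ dist v w) (G.sqDist v′ w′)
    (≈-sym (dist v w ⊗ dist v w) (G.sqDist v w) (dist-square v w))
    (≈-trans (dist v w ⊗ dist v w) (dist v′ w′ ⊗ dist v′ w′) (G.sqDist v′ w′)
      (G.*-cong {dist v w} {dist v′ w′} {dist v w} {dist v′ w′} eq eq) (dist-square v′ w′))

-- Diameter and circumradius as bounds on squared distances

Fin-inhabited? : ∀ n → Dec (Fin n)
Fin-inhabited? zero    = no λ ()
Fin-inhabited? (suc n) = yes zero

δ-1<δ : ∀ δ → δ - fromℚ 1ℚ < δ
δ-1<δ δ = 1ℚ , ℚₚ.positive⁻¹ 1ℚ , always λ n → ℚₚ.≤-reflexive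
  (solve 1 (λ d → d :- con 1ℚ :+ con 1ℚ := d) refl (seq δ n))
  where open +-*-Solver

-- For an empty set every real is an upper bound of the distances, `δ - 1` included, so there is no
-- least one.
diameter⇒inhabited : ∀ {n} (P : FiniteSet n) δ → IsDiameter P δ → Fin (size P)
diameter⇒inhabited P δ (_ , least) = decidable-stable (Fin-inhabited? (size P)) λ empty →
  <⇒≱ (δ - fromℚ 1ℚ) δ (δ-1<δ δ)
    (least (δ - fromℚ 1ℚ) λ _ (i , _) → contradiction i empty)

dist≤⇒sqDist≤ : ∀ {n} (v w : ℝ^ n) δ → dist v w ≤ δ → G.sqDist v w ≤ δ ⊗ δ
dist≤⇒sqDist≤ v w δ d≤δ = ≤-trans (G.sqDist v w) (dist v w ⊗ dist v w) (δ ⊗ δ)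
  (≈⇒≤ (G.sqDist v w) (dist v w ⊗ dist v w)
    (≈-sym (dist v w ⊗ dist v w) (G.sqDist v w) (dist-square v w)))
  (G.square-mono-≤ {dist v w} {δ} (0≤dist v w) d≤δ)

≤dist⇒≤sqDist : ∀ {n} (v w : ℝ^ n) ρ → 0ℝ ≤ ρ → ρ ≤ dist v w → ρ ⊗ ρ ≤ G.sqDist v w
≤dist⇒≤sqDist v w ρ 0≤ρ ρ≤d = ≤-trans (ρ ⊗ ρ) (dist v w ⊗ dist v w) (G.sqDist v w)
  (G.square-mono-≤ {ρ} {dist v w} 0≤ρ ρ≤d)
  (≈⇒≤ (dist v w ⊗ dist v w) (G.sqDist v w) (dist-square v w))

dist≈⇒sqDist≈ : ∀ {n} (v w : ℝ^ n) ρ → dist v w ≈ ρ → G.sqDist v w ≈ ρ ⊗ ρ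
dist≈⇒sqDist≈ v w ρ d≈ρ = ≈-trans (G.sqDist v w) (dist v w ⊗ dist v w) (ρ ⊗ ρ)
  (≈-sym (dist v w ⊗ dist v w) (G.sqDist v w) (dist-square v w))
  (G.*-cong {dist v w} {ρ} {dist v w} {ρ} d≈ρ d≈ρ)

diameter-nonNeg : ∀ {n} (P : FiniteSet n) δ → IsDiameter P δ → Fin (size P) → 0ℝ ≤ δ
diameter-nonNeg P δ (upper , _) i = ≤-trans 0ℝ (dist (point P i) (point P i)) δ
  (0≤dist (point P i) (point P i))
  (upper (dist (point P i) (point P i)) (i , i , ≈-refl (dist (point P i) (point P i))))

sqDist-diameter : ∀ {n} (P : FiniteSet n) δ δ′ → IsDiameter P δ′ → δ′ ≤ δ →
  ∀ i j → G.sqDist (point P i) (point P j) ≤ δ ⊗ δ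
sqDist-diameter P δ δ′ (upper , _) δ′≤δ i j = dist≤⇒sqDist≤ (point P i) (point P j) δ
  (≤-trans (dist (point P i) (point P j)) δ′ δ
    (upper (dist (point P i) (point P j)) (i , j , ≈-refl (dist (point P i) (point P j))))
    δ′≤δ)

equidistant⇒sphere : ∀ {n} (P : FiniteSet n) c R i →
  (∀ j → G.sqDist (point P j) c ≈ R) → LiesOnSphereOfRadius P (dist (point P i) c)
equidistant⇒sphere P c R i eq = 0≤dist (point P i) c , c , λ j →
  sqDist⇒dist (point P j) c (point P i) c
    (≈-trans (G.sqDist (point P j) c) R (G.sqDist (point P i) c) (eq j)
      (≈-sym (G.sqDist (point P i) c) R (eq i)))

-- Keeps the passage to the affine hull from making the radius too small: the sphere about the new
-- centre still contains `P`, so minimality of `ρ` applies to it.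
circumradius-minimal : ∀ {n} (P : FiniteSet n) {ρ} → IsCircumradius P ρ → ∀ c R →
  Fin (size P) → (∀ j → G.sqDist (point P j) c ≈ R) → ρ ⊗ ρ ≤ R
circumradius-minimal P {ρ} ((0≤ρ , _) , minimal) c R i eq =
  ≤-trans (ρ ⊗ ρ) (G.sqDist (point P i) c) R
    (≤dist⇒≤sqDist (point P i) c ρ 0≤ρ
      (minimal (dist (point P i) c) (equidistant⇒sphere P c R i eq)))
    (≈⇒≤ (G.sqDist (point P i) c) R (eq i))

-- By contraposition: 2R ≤ δ² would give ρ² ≤ R ≤ (δ√½)², hence ρ ≤ δ√½.
large-circumradius : ∀ δ ρ R → 0ℝ ≤ δ → δ * √ (fromℚ ½) < ρ → ρ ⊗ ρ ≤ R →
  ¬ (R ⊕ R ≤ δ ⊗ δ)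
large-circumradius δ ρ R 0≤δ s<ρ ρ²≤R 2R≤δ² = <⇒≱ (δ * √ (fromℚ ½)) ρ s<ρ
  (≤-trans ρ (δ ⊗ √ (fromℚ ½)) (δ * √ (fromℚ ½))
    (G.square-cancel-≤ {ρ} {δ ⊗ √ (fromℚ ½)}
      (0≤⊗ δ (√ (fromℚ ½)) 0≤δ (0≤√ (fromℚ ½)))
      (≤-trans (ρ ⊗ ρ) R ((δ ⊗ √ (fromℚ ½)) ⊗ (δ ⊗ √ (fromℚ ½))) ρ²≤R
        (G.half-square {R} {δ} {√ (fromℚ ½)} (√-⊗ (fromℚ ½) 0≤½) 0≤½ 2R≤δ²)))
    (≈⇒≤ (δ ⊗ √ (fromℚ ½)) (δ * √ (fromℚ ½))
      (≈-sym (δ * √ (fromℚ ½)) (δ ⊗ √ (fromℚ ½))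
        (*≈⊗ δ δ (√ (fromℚ ½)) (√ (fromℚ ½)) (≈-refl δ) (≈-refl (√ (fromℚ ½)))))))
  where
  0≤½ : 0ℝ ≤ fromℚ ½
  0≤½ = pointwise-≤ 0ℝ (fromℚ ½) λ _ → ℚₚ.nonNegative⁻¹ ½

-- Congruent subsets as index maps

congruent⇒sqDist : ∀ {m n} (P : FiniteSet m) (Q : FiniteSet n) (f : Fin (size P) → Fin (size Q)) →
  (∀ i j → dist (point Q (f i)) (point Q (f j)) ≈ dist (point P i) (point P j)) →
  ∀ i j {i′ j′} → f i ≡ i′ → f j ≡ j′ →
  G.sqDist (point P i) (point P j) ≈ G.sqDist (point Q i′) (point Q j′)
congruent⇒sqDist P Q f isometry i j refl refl =
  dist⇒sqDist (point P i) (point P j) (point Q (f i)) (point Q (f j))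
    (≈-sym (dist (point Q (f i)) (point Q (f j))) (dist (point P i) (point P j))
      (isometry i j))

-- The index map from `A` to `B` inverts the congruence and then locates each point of `A′` in `B`.
-- Points agree with their representatives only up to `≈ᵛ`, so isometry and membership are
-- transported along `close`.
copy⇒not-avoiding : ∀ {d n r R} (A : FiniteSet d) (B : FiniteSet n) (i₀ : Fin (size A))
  (C : G.AffineCentre (point A) R) D (χ : Colouring B r) (A′ : FiniteSet n) →
  A′ ⊆ B → Monochromatic B χ A′ → Congruent A′ A → ¬ G.Avoids i₀ C D (point B) χ
copy⇒not-avoiding A B i₀ C D χ A′ A′⊆B mono (f , isometry) avoids =
  avoids (λ i → proj₁ (A′⊆B (from i)))
    (λ i j → ≈-trans
      (G.sqDist (point B (proj₁ (A′⊆B (from i)))) (point B (proj₁ (A′⊆B (from j)))))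
      (G.sqDist (point A′ (from i)) (point A′ (from j)))
      (G.sqDist (point A i) (point A j))
      (G.sqDist-cong {u = point B (proj₁ (A′⊆B (from i)))} {point A′ (from i)}
        {point B (proj₁ (A′⊆B (from j)))} {point A′ (from j)} (close i) (close j))
      (congruent⇒sqDist A′ A to isometry (from i) (from j)
        (proj₂ (strictlySurjective i)) (proj₂ (strictlySurjective j))))
    (λ i j → mono (proj₁ (A′⊆B (from i))) (proj₁ (A′⊆B (from j)))
      (from i , close i) (from j , close j))
  where
  open Bijection f using (to; strictlySurjective)

  from : Fin (size A) → Fin (size A′)
  from i = proj₁ (strictlySurjective i)

  close : ∀ i → point B (proj₁ (A′⊆B (from i))) ≈ᵛ point A′ (from i)
  close i k = ≈-sym (point A′ (from i) k) (point B (proj₁ (A′⊆B (from i))) k)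
    (proj₂ (A′⊆B (from i)) k)

theorem1p2 : (d : ℕ) → NonZero d → (A : FiniteSet d) → Spherical A →
    (δ ρ : ℝ) → IsDiameter A δ → IsCircumradius A ρ →
    δ * √ (fromℚ ½) < ρ → ¬ (DiameterRamsey A)
theorem1p2 d _ A _ δ ρ A-diameter circumradius@((_ , c , on-sphere) , _) s<ρ ramsey =
  G.affineCentre (point A) i₀ c (ρ ⊗ ρ)
    (λ i → dist≈⇒sqDist≈ (point A i) c ρ (on-sphere i)) λ { (R , C) →
  let open G.AffineCentre C in
  G.avoiding-colouring i₀ C (δ ⊗ δ)
    (large-circumradius δ ρ R (diameter-nonNeg A δ A-diameter i₀) s<ρ
      (circumradius-minimal A circumradius (G.combination weights (point A)) R i₀ equidistant))
    λ { (r , avoid) →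
  let (n , _ , B , (δ′ , A-diameter′ , B-diameter) , copy) = ramsey (suc r) _ in
  avoid (point B) (diameter⇒inhabited B δ′ B-diameter)
    -- `ramsey` brings its own diameter `δ′` of `A`; its leastness gives `δ′ ≤ δ`.
    (sqDist-diameter B δ δ′ B-diameter (proj₂ A-diameter′ δ (proj₁ A-diameter)))
    λ { (χ , avoids) →
  let (A′ , A′⊆B , mono , congruent) = copy χ in
  copy⇒not-avoiding A B i₀ C (δ ⊗ δ) χ A′ A′⊆B mono congruent avoids }}}
  where
  i₀ : Fin (size A)
  i₀ = diameter⇒inhabited A δ A-diameter
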